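{- On formal power series in $x$ consider the binary operations $$\gamma_{\sqcup}(f,g)=\text{the Hadamard (coefficientwise) product of } f \text{ and } g,\qquad \gamma_{\oplus}(f,g)=f\,(1-x)\,g .$$ Then the $\mathcal{SP}$-algebra generated by $\mathcal{SH}(1)=\frac{1}{(1-x)^2}$ under these operations is the $\mathcal{SP}$-algebra of shuffle series. That is, for every series-parallel poset $P$ with $|P|=n$ and every factorization of $P$, replacing each of the $n$ leaves of the factorization by $\frac{1}{(1-x)^2}$ and evaluating each vertex labeled $\sqcup$ by $\gamma_\sqcup$ and each vertex labeled $\oplus$ by $\gamma_\oplus$ yields at the root exactly the shuffle series $\mathcal{SH}(P)$.
   Context: Posets are finite and considered up to isomorphism. $\langle n\rangle$ is the chain $1<2<\cdots<n$ ($\langle 0\rangle$ is empty). $P\sqcup Q$ is the disjoint union of posets (no new relations); $P\oplus Q$ is the ordinal sum (every element of $P$ is put below every element of $Q$). A series-parallel poset ($SP$-poset) is a poset obtained from one-point posets by finitely many applications of $\sqcup$ and $\oplus$. A factorization of an $SP$-poset $P$ with $n$ points is a planar rooted binary tree with $n$ leaves whose vertices are labeled by $\sqcup$ or $\oplus$, such that evaluating it with a one-point poset at each leaf gives $P$. Shuffles. Let $P$ be an $SP$-poset. A (colimit-indexing) shuffle of $P$ and $\langle n\rangle$ is a finite poset $A$ such that: every point of $A$ is labeled by a point of $P$ or a point of $\langle n\rangle$; $A$ has the same number of minimal points as $P$; $A$ has the same number of maximal points as $P$; and there is a bijection $M\mapsto A_M$ from maximal chains of $P$ to maximal chains of $A$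 such that $A_M$ is a shuffle of $M$ and $\langle n\rangle$, i.e. the labels along $A_M$ list every element of $M$ and every element of $\langle n\rangle$ exactly once, preserving the order of $M$ and the order of $\langle n\rangle$. Every point of $P$ labels exactly one point of $A$ (a point of $\langle n\rangle$ may label several points of $A$), and two shuffles are identified if for every maximal chain $M$ of $P$ the label sequences along the corresponding chains coincide. $\hom_{Shuffle}(P,\langle n\rangle)$ is the set of such shuffles; for $n=0$ the only shuffle is $P$ itself. The shuffle series is $\mathcal{SH}(P)=\sum_{n=0}^\infty \#\hom_{Shuffle}(P,\langle n\rangle)x^n$, and $\mathcal{SH}(k):=\mathcal{SH}(\langle k\rangle)$. -}

module Defs where

open import Data.Fin.Base as Fin using (Fin; toℕ)
import Data.Fin.Properties as Fin
open import Data.Integer.Base as ℤ using (ℤ; +_; 0ℤ; 1ℤ; -1ℤ)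
import Data.Integer.Properties as ℤ
open import Data.List.Base using (List; map; allFin)
open import Data.List.Membership.Propositional using (_∈_)
open import Data.List.Relation.Ternary.Interleaving.Propositional using (Interleaving)
open import Data.List.Relation.Unary.AllPairs using (AllPairs)
open import Data.Nat.Base using (ℕ; zero; suc; _+_; _∸_)
open import Data.Product using (Σ; ∃; ∃!; _×_; _,_; proj₁)
open import Data.Sum.Base using (_⊎_; inj₁; inj₂)
open import Data.Sum.Function.Propositional using (_⊎-↔_)
open import Data.Sum.Relation.Binary.LeftOrder using (_⊎-<_; ⊎-<-isPartialOrder; ⊎-<-decidable)
open import Data.Sum.Relation.Binary.Pointwise
  using (Pointwise; ⊎-isPartialOrder; ⊎-decidable; ≡⇒Pointwise-≡; Pointwise-≡⇒≡)
open import Data.Sum.Properties using (≡-dec)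
open import Function.Base using (_∘_)
open import Function.Bundles using (Inverse; _↔_)
open import Function.Construct.Composition using (_↔-∘_)
open import Function.Construct.Identity using (↔-id)
open import Function.Construct.Symmetry using (↔-sym)
open import Level using (0ℓ) renaming (suc to ℓsuc)
open import Relation.Binary.Bundles using (Setoid)
open import Relation.Binary.Core using (Rel)
import Relation.Binary.Construct.NonStrictToStrict as ToStrict
import Relation.Binary.Construct.On as On
open import Relation.Binary.Morphism.Structures using (IsOrderIsomorphism)
open import Relation.Binary.PropositionalEquality
  using (_≡_; refl; sym; trans; cong; cong₂; setoid; isEquivalence; module ≡-Reasoning)
open import Relation.Binary.Structures using (IsPartialOrder; IsDecPartialOrder)
open import Algebra.Definitions.RawMonoid ℤ.+-0-rawMonoid using (sum)

------------------------------------------------------------------------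
-- Finite posets

-- Equality of points is propositional.  Classically every finite poset is
-- decidable, so asking for a decidable order excludes nothing.

record FinPoset : Set₁ where
  infix 4 _≤_ _<_
  field
    Carrier           : Set
    _≤_               : Rel Carrier 0ℓ
    isDecPartialOrder : IsDecPartialOrder _≡_ _≤_
    size              : ℕ
    enumeration       : Carrier ↔ Fin size

  _<_ : Rel Carrier 0ℓ
  _<_ = ToStrict._<_ _≡_ _≤_

  open IsDecPartialOrder isDecPartialOrder public
    using (_≟_; _≤?_; isPartialOrder)

open FinPoset using (Carrier; size)

infix 4 _≅_

_≅_ : FinPoset → FinPoset → Set
P ≅ Q = ∃ (IsOrderIsomorphism _≡_ _≡_ (FinPoset._≤_ P) (FinPoset._≤_ Q))

⟨_⟩ : ℕ → FinPoset
⟨ n ⟩ = record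
  { Carrier           = Fin n
  ; _≤_               = Fin._≤_
  ; isDecPartialOrder = record
    { isPartialOrder = Fin.≤-isPartialOrder
    ; _≟_            = Fin._≟_
    ; _≤?_           = Fin._≤?_
    }
  ; size              = n
  ; enumeration       = ↔-id (Fin n)
  }

isPartialOrder-≡ : ∀ {A B : Set} {R : Rel (A ⊎ B) 0ℓ} →
                   IsPartialOrder (Pointwise _≡_ _≡_) R → IsPartialOrder _≡_ R
isPartialOrder-≡ po = record
  { isPreorder = record
    { isEquivalence = isEquivalence
    ; reflexive     = po.reflexive ∘ ≡⇒Pointwise-≡
    ; trans         = po.trans
    }
  ; antisym    = λ x≤y y≤x → Pointwise-≡⇒≡ (po.antisym x≤y y≤x)
  }
  where module po = IsPartialOrder po

infixr 6 _⊔_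
infixr 7 _⊕_

_⊔_ : FinPoset → FinPoset → FinPoset
P ⊔ Q = record
  { Carrier           = P.Carrier ⊎ Q.Carrier
  ; _≤_               = Pointwise P._≤_ Q._≤_
  ; isDecPartialOrder = record
    { isPartialOrder = isPartialOrder-≡ (⊎-isPartialOrder P.isPartialOrder Q.isPartialOrder)
    ; _≟_            = ≡-dec P._≟_ Q._≟_
    ; _≤?_           = ⊎-decidable P._≤?_ Q._≤?_
    }
  ; size              = P.size + Q.size
  ; enumeration       = ↔-sym Fin.+↔⊎ ↔-∘ (P.enumeration ⊎-↔ Q.enumeration)
  }
  where module P = FinPoset P
        module Q = FinPoset Q

_⊕_ : FinPoset → FinPoset → FinPoset
P ⊕ Q = record
  { Carrier           = P.Carrier ⊎ Q.Carrier
  ; _≤_               = P._≤_ ⊎-< Q._≤_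
  ; isDecPartialOrder = record
    { isPartialOrder = isPartialOrder-≡ (⊎-<-isPartialOrder P.isPartialOrder Q.isPartialOrder)
    ; _≟_            = ≡-dec P._≟_ Q._≟_
    ; _≤?_           = ⊎-<-decidable P._≤?_ Q._≤?_
    }
  ; size              = P.size + Q.size
  ; enumeration       = ↔-sym Fin.+↔⊎ ↔-∘ (P.enumeration ⊎-↔ Q.enumeration)
  }
  where module P = FinPoset P
        module Q = FinPoset Q

-- Posets are considered up to isomorphism, hence the last constructor.

data SeriesParallel : FinPoset → Set₁ where
  point          : SeriesParallel ⟨ 1 ⟩
  disjoint-union : ∀ {P Q} → SeriesParallel P → SeriesParallel Q → SeriesParallel (P ⊔ Q)
  ordinal-sum    : ∀ {P Q} → SeriesParallel P → SeriesParallel Q → SeriesParallel (P ⊕ Q)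
  isomorphic     : ∀ {P Q} → P ≅ Q → SeriesParallel P → SeriesParallel Q

------------------------------------------------------------------------
-- Factorizations

data Vertex : Set where
  ⊔-vertex ⊕-vertex : Vertex

-- Planar rooted binary trees, indexed by their number of leaves.

data Tree : ℕ → Set where
  leaf : Tree 1
  node : ∀ {m n} → Vertex → Tree m → Tree n → Tree (m + n)

evalPoset : ∀ {n} → Tree n → FinPoset
evalPoset leaf                = ⟨ 1 ⟩
evalPoset (node ⊔-vertex s t) = evalPoset s ⊔ evalPoset t
evalPoset (node ⊕-vertex s t) = evalPoset s ⊕ evalPoset t

record Factorization (P : FinPoset) : Set where
  field
    tree       : Tree (size P)
    evaluation : evalPoset tree ≅ P

------------------------------------------------------------------------
-- Minimal points, maximal points, maximal chains

module _ (P : FinPoset) where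
  open FinPoset P using (_≤_; _<_)

  Minimal Maximal : Carrier P → Set
  Minimal x = ∀ {y} → y ≤ x → y ≡ x
  Maximal x = ∀ {y} → x ≤ y → y ≡ x

  MinimalPoints MaximalPoints : Setoid 0ℓ 0ℓ
  MinimalPoints = On.setoid (setoid (Carrier P)) (proj₁ {B = Minimal})
  MaximalPoints = On.setoid (setoid (Carrier P)) (proj₁ {B = Maximal})

  -- A chain is given by the strictly increasing list of its points, so that
  -- equal chains are those with equal lists.

  record MaximalChain : Set where
    field
      points     : List (Carrier P)
      increasing : AllPairs _<_ points
      maximal    : ∀ x → (∀ {y} → y ∈ points → x ≤ y ⊎ y ≤ x) → x ∈ points

  MaximalChains : Setoid 0ℓ 0ℓ
  MaximalChains = On.setoid (setoid (List (Carrier P))) MaximalChain.points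

open MaximalChain using (points)

------------------------------------------------------------------------
-- Shuffles

record Shuffle (P : FinPoset) (n : ℕ) : Set₁ where
  field
    A             : FinPoset
    label         : Carrier A → Carrier P ⊎ Carrier ⟨ n ⟩
    minimalPoints : Inverse (MinimalPoints P) (MinimalPoints A)
    maximalPoints : Inverse (MaximalPoints P) (MaximalPoints A)
    chains        : Inverse (MaximalChains P) (MaximalChains A)

  labels : MaximalChain P → List (Carrier P ⊎ Carrier ⟨ n ⟩)
  labels M = map label (points (Inverse.to chains M))

  field
    shuffled : ∀ M → Interleaving (map inj₁ (points M)) (map inj₂ (allFin n)) (labels M)
    unique   : ∀ p → ∃! _≡_ λ a → label a ≡ inj₁ p

-- hom_Shuffle(P, ⟨n⟩); A, the label map and the bijections matter only
-- through the label sequences.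

Shuffles : FinPoset → ℕ → Setoid (ℓsuc 0ℓ) 0ℓ
Shuffles P n = record
  { Carrier       = Shuffle P n
  ; _≈_           = λ S T → ∀ M → Shuffle.labels S M ≡ Shuffle.labels T M
  ; isEquivalence = record
    { refl  = λ M → refl
    ; sym   = λ e M → sym (e M)
    ; trans = λ e f M → trans (e M) (f M)
    }
  }

------------------------------------------------------------------------
-- Formal power series with integer coefficients

PowerSeries : Set
PowerSeries = ℕ → ℤ

infix  4 _≈_
infixl 7 _·_ _⊙_

_≈_ : Rel PowerSeries 0ℓ
f ≈ g = ∀ n → f n ≡ g n

_·_ : PowerSeries → PowerSeries → PowerSeries
(f · g) n = sum {suc n} λ i → f (toℕ i) ℤ.* g (n ∸ toℕ i)

_⊙_ : PowerSeries → PowerSeries → PowerSeries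
(f ⊙ g) n = f n ℤ.* g n

[1] : PowerSeries
[1] zero    = 1ℤ
[1] (suc n) = 0ℤ

[1-x] : PowerSeries
[1-x] zero          = 1ℤ
[1-x] (suc zero)    = -1ℤ
[1-x] (suc (suc n)) = 0ℤ

1/[1-x]² : PowerSeries
1/[1-x]² n = + suc n

γ⊔ γ⊕ : PowerSeries → PowerSeries → PowerSeries
γ⊔ f g = f ⊙ g
γ⊕ f g = f · [1-x] · g

-- The coefficients chosen for 1/[1-x]² are justified by 1/[1-x]²-inverse.

[1-x]·-suc : ∀ f n → ([1-x] · f) (suc n) ≡ f (suc n) ℤ.- f n
[1-x]·-suc f n = cong₂ ℤ._+_ (ℤ.*-identityˡ (f (suc n)))
  (trans (cong₂ ℤ._+_ (ℤ.-1*i≡-i (f n)) (zeros n λ i → f (n ∸ toℕ (Fin.suc i)))) (ℤ.+-identityʳ _))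
  where
  zeros : ∀ m (h : Fin m → ℤ) → sum {m} (λ i → 0ℤ ℤ.* h i) ≡ 0ℤ
  zeros zero    h = refl
  zeros (suc m) h = trans (ℤ.+-identityˡ _) (zeros m (h ∘ Fin.suc))

1/[1-x]²-inverse : [1-x] · ([1-x] · 1/[1-x]²) ≈ [1]
1/[1-x]²-inverse zero    = refl
1/[1-x]²-inverse (suc n) = begin
  ([1-x] · g) (suc n)     ≡⟨ [1-x]·-suc g n ⟩
  g (suc n) ℤ.- g n       ≡⟨ cong₂ ℤ._-_ (ones (suc n)) (ones n) ⟩
  0ℤ                      ∎
  where
  open ≡-Reasoning
  g = [1-x] · 1/[1-x]²
  ones : ∀ m → g m ≡ 1ℤ
  ones zero    = refl
  ones (suc m) = begin
    g (suc m)                            ≡⟨ [1-x]·-suc 1/[1-x]² m ⟩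
    (1ℤ ℤ.+ + suc m) ℤ.- + suc m         ≡⟨ ℤ.+-assoc 1ℤ (+ suc m) (ℤ.- + suc m) ⟩
    1ℤ ℤ.+ (+ suc m ℤ.- + suc m)         ≡⟨ cong (λ i → 1ℤ ℤ.+ i) (ℤ.+-inverseʳ (+ suc m)) ⟩
    1ℤ                                   ∎

evalSeries : ∀ {n} → Tree n → PowerSeries
evalSeries leaf                = 1/[1-x]²
evalSeries (node ⊔-vertex s t) = γ⊔ (evalSeries s) (evalSeries t)
evalSeries (node ⊕-vertex s t) = γ⊕ (evalSeries s) (evalSeries t)

data Generated (g : PowerSeries) : PowerSeries → Set where
  generator : Generated g g
  γ⊔-closed : ∀ {f h} → Generated g f → Generated g h → Generated g (γ⊔ f h)
  γ⊕-closed : ∀ {f h} → Generated g f → Generated g h → Generated g (γ⊕ f h)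
  respects  : ∀ {f h} → f ≈ h → Generated g f → Generated g h

-- f = 𝒮ℋ(P): for each n, hom_Shuffle(P, ⟨n⟩) has exactly k elements for
-- some k, and k is the n-th coefficient of f.

infix 4 _IsShuffleSeriesOf_

_IsShuffleSeriesOf_ : PowerSeries → FinPoset → Set₁
f IsShuffleSeriesOf P =
  ∀ n → Σ ℕ λ k → Inverse (Shuffles P n) (setoid (Fin k)) × f n ≡ + k

{-# OPTIONS --safe #-}
module Submission where

-- A shuffle of P and ⟨ n ⟩ amounts to an order-preserving map P → {0, …, n}, sending p to the number
-- of elements of ⟨ n ⟩ that precede p.  That number does not depend on the maximal chain through p in
-- which it is read off: exchanging the upper parts of two maximal chains of A at the point labelled p
-- gives a maximal chain of A, and its labels again list ⟨ n ⟩ once.  Conversely, maps are realized by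
-- shuffles recursively, since maximal chains of P ⊔ Q and P ⊕ Q are those of P or Q and pairs of such.
--
-- Order-preserving maps on P ⊔ Q are pairs of maps, whence the Hadamard product.  Those on P ⊕ Q with
-- maximum i on P are pairs of a map on P with maximum exactly i, counted by the i-th coefficient of
-- 𝒮ℋ(P) (1 - x), and a map from Q to {i, …, n}.

open import Defs
import Algebra.Definitions.RawMonoid as RawMonoid
open import Data.Fin.Base as Fin using (Fin; zero; suc; toℕ; fromℕ; fromℕ<; _↑ˡ_; _↑ʳ_)
open import Data.Fin.Permutation using (↔⇒≡)
import Data.Fin.Properties as Fin
open import Data.Integer.Base as ℤ using (ℤ; +_; 0ℤ; 1ℤ; -1ℤ)
import Data.Integer.Properties as ℤ
open import Data.List.Base using (List; []; _∷_; _++_; map; length; mapMaybe; allFin; tabulate)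
open import Data.List.Membership.Propositional using (_∈_)
open import Data.List.Membership.Propositional.Properties
  using (∈-map⁺; ∈-map⁻; ∈-++⁺ˡ; ∈-++⁺ʳ; ∈-++⁻; ∈-allFin)
open import Data.List.Properties
  using (mapMaybe-++; mapMaybeIsInj₁∘mapInj₁; mapMaybeIsInj₁∘mapInj₂; mapMaybeIsInj₂∘mapInj₁;
         mapMaybeIsInj₂∘mapInj₂; map-++; map-∘; map-cong; map-id; map-injective; map-tabulate;
         length-++; length-map; length-tabulate; ++-identityʳ; ∷-injective)
open import Data.List.Relation.Ternary.Interleaving.Propositional
  using (Interleaving; []; _∷ˡ_; _∷ʳ_)
open import Data.List.Relation.Unary.All as All using (All; []; _∷_)
import Data.List.Relation.Unary.All.Properties as All
open import Data.List.Relation.Unary.AllPairs as AllPairs using (AllPairs; []; _∷_)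
import Data.List.Relation.Unary.AllPairs.Properties as AllPairs
open import Data.List.Relation.Unary.Any using (here; there)
open import Data.Nat.Base as ℕ using (ℕ; zero; suc; _+_; _∸_; z≤n; s≤s)
import Data.Nat.Properties as ℕ
open import Data.Product.Base using (Σ; ∃; ∃₂; _×_; _,_; proj₁; proj₂)
open import Data.Product.Function.NonDependent.Setoid using (_×-inverse_)
import Data.Product.Relation.Binary.Pointwise.NonDependent as ×
open × using (_×ₛ_)
open import Data.Sum as Sum using (_⊎_; inj₁; inj₂; isInj₁; isInj₂)
open import Data.Sum.Function.Setoid using (_⊎-inverse_)
open import Data.Sum.Properties using (inj₁-injective; inj₂-injective)
open import Data.Sum.Relation.Binary.LeftOrder using (₁∼₂; ₁∼₁; ₂∼₂; drop-inj₁; drop-inj₂)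
import Data.Sum.Relation.Binary.Pointwise as ⊎
open ⊎ using (inj₁; inj₂; _⊎ₛ_)
open import Function.Base using (_∘_; id)
open import Function.Bundles using (Inverse; _⇔_; mk⇔)
import Function.Construct.Composition as Composition
import Function.Construct.Symmetry as Symmetry
open import Relation.Binary.Bundles using (Setoid)
import Relation.Binary.Construct.NonStrictToStrict as ToStrict
import Relation.Binary.Construct.On as On
open import Relation.Binary.Morphism.Structures using (IsOrderIsomorphism)
open import Relation.Binary.PropositionalEquality
  using (_≡_; _≢_; refl; sym; trans; cong; cong₂; subst; subst₂; setoid; module ≡-Reasoning)
open import Relation.Binary.Structures using (IsPartialOrder)
open import Relation.Nullary.Decidable.Core using (Dec; yes; no)
open import Relation.Nullary.Negation using (¬_; contradiction)

open FinPoset using (Carrier)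
open MaximalChain using (points; increasing; maximal)

-- The factor 1 - x corrects an overcount. A shuffle of P with `⟨ k ⟩` followed by a shuffle of Q
-- with `⟨ n ∸ k ⟩` gives a shuffle of P ⊕ Q with `⟨ n ⟩`, but the cut k cannot be recovered from
-- the label sequences: every k between the maximum of the map on P and its minimum on Q would do.
-- Requiring that k be the maximum on P makes the cut canonical, and the maps with maximum exactly k
-- are those bounded by k minus those bounded by k - 1.
--
-- Equality of shuffles sees label sequences only; the posets A are never compared. Hence the
-- recursion has to supply just one shuffle for each map. A label sequence is determined by its
-- P-labels, its `⟨ n ⟩`-labels and the positions of the former among the latter, so this one
-- shuffle represents its whole class.
--
-- Reading off and comparing positions requires maximal chains through given points, and both sums
-- require nonempty summands. These facts are built along the series-parallel construction and
-- carried in `Shuffleable`; the counting itself deals with order-preserving maps only.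

module _ {a b ℓ₁ ℓ₂} {S : Setoid a ℓ₁} {T : Setoid b ℓ₂} where
  private
    module S = Setoid S
    module T = Setoid T

  mkInverse : (to : S.Carrier → T.Carrier) (from : T.Carrier → S.Carrier) →
              (∀ {x y} → x S.≈ y → to x T.≈ to y) →
              (∀ {x y} → x T.≈ y → from x S.≈ from y) →
              (∀ y → to (from y) T.≈ y) → (∀ x → from (to x) S.≈ x) → Inverse S T
  mkInverse to from to-cong from-cong to∘from from∘to = record
    { to        = to
    ; from      = from
    ; to-cong   = to-cong
    ; from-cong = from-cong
    ; inverse   = (λ x≈ → T.trans (to-cong x≈) (to∘from _)) , (λ y≈ → S.trans (from-cong y≈) (from∘to _))
    }

  singletons : (s : S.Carrier) (t : T.Carrier) → (∀ x → s S.≈ x) → (∀ y → t T.≈ y) → Inverse S T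
  singletons s t s≈ t≈ = mkInverse (λ _ → t) (λ _ → s) (λ _ → T.refl) (λ _ → S.refl) t≈ s≈

-- Lists over a disjoint sum

module _ {A B : Set} where

  lefts : List (A ⊎ B) → List A
  lefts = mapMaybe isInj₁

  rights : List (A ⊎ B) → List B
  rights = mapMaybe isInj₂

  ∈-lefts⁺ : ∀ {x} {zs : List (A ⊎ B)} → inj₁ x ∈ zs → x ∈ lefts zs
  ∈-lefts⁺ (here refl)                = here refl
  ∈-lefts⁺ {zs = inj₁ _ ∷ _} (there i) = there (∈-lefts⁺ i)
  ∈-lefts⁺ {zs = inj₂ _ ∷ _} (there i) = ∈-lefts⁺ i

  ∈-lefts⁻ : ∀ {x} (zs : List (A ⊎ B)) → x ∈ lefts zs → inj₁ x ∈ zs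
  ∈-lefts⁻ (inj₁ _ ∷ zs) (here refl) = here refl
  ∈-lefts⁻ (inj₁ _ ∷ zs) (there i)   = there (∈-lefts⁻ zs i)
  ∈-lefts⁻ (inj₂ _ ∷ zs) i           = there (∈-lefts⁻ zs i)

  ∈-rights⁺ : ∀ {y} {zs : List (A ⊎ B)} → inj₂ y ∈ zs → y ∈ rights zs
  ∈-rights⁺ (here refl)                = here refl
  ∈-rights⁺ {zs = inj₁ _ ∷ _} (there i) = ∈-rights⁺ i
  ∈-rights⁺ {zs = inj₂ _ ∷ _} (there i) = there (∈-rights⁺ i)

  ∈-rights⁻ : ∀ {y} (zs : List (A ⊎ B)) → y ∈ rights zs → inj₂ y ∈ zs
  ∈-rights⁻ (inj₁ _ ∷ zs) i           = there (∈-rights⁻ zs i)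
  ∈-rights⁻ (inj₂ _ ∷ zs) (here refl) = here refl
  ∈-rights⁻ (inj₂ _ ∷ zs) (there i)   = there (∈-rights⁻ zs i)

  All-lefts⁺ : ∀ {p q} {P : A ⊎ B → Set p} {Q : A → Set q} → (∀ {x} → P (inj₁ x) → Q x) →
               ∀ {zs} → All P zs → All Q (lefts zs)
  All-lefts⁺ f {[]}          []       = []
  All-lefts⁺ f {inj₁ _ ∷ zs} (p ∷ ps) = f p ∷ All-lefts⁺ f ps
  All-lefts⁺ f {inj₂ _ ∷ zs} (_ ∷ ps) = All-lefts⁺ f ps

  All-rights⁺ : ∀ {p q} {P : A ⊎ B → Set p} {Q : B → Set q} → (∀ {y} → P (inj₂ y) → Q y) →
                ∀ {zs} → All P zs → All Q (rights zs)
  All-rights⁺ f {[]}          []       = []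
  All-rights⁺ f {inj₁ _ ∷ zs} (_ ∷ ps) = All-rights⁺ f ps
  All-rights⁺ f {inj₂ _ ∷ zs} (p ∷ ps) = f p ∷ All-rights⁺ f ps

  AllPairs-lefts⁺ : {R : A ⊎ B → A ⊎ B → Set} {T : A → A → Set} →
                    (∀ {x y} → R (inj₁ x) (inj₁ y) → T x y) →
                    ∀ {zs} → AllPairs R zs → AllPairs T (lefts zs)
  AllPairs-lefts⁺ f {[]}          []       = []
  AllPairs-lefts⁺ f {inj₁ _ ∷ zs} (r ∷ rs) = All-lefts⁺ f r ∷ AllPairs-lefts⁺ f rs
  AllPairs-lefts⁺ f {inj₂ _ ∷ zs} (_ ∷ rs) = AllPairs-lefts⁺ f rs

  AllPairs-rights⁺ : {R : A ⊎ B → A ⊎ B → Set} {T : B → B → Set} →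
                     (∀ {x y} → R (inj₂ x) (inj₂ y) → T x y) →
                     ∀ {zs} → AllPairs R zs → AllPairs T (rights zs)
  AllPairs-rights⁺ f {[]}          []       = []
  AllPairs-rights⁺ f {inj₁ _ ∷ zs} (_ ∷ rs) = AllPairs-rights⁺ f rs
  AllPairs-rights⁺ f {inj₂ _ ∷ zs} (r ∷ rs) = All-rights⁺ f r ∷ AllPairs-rights⁺ f rs

  Interleaving⇒lefts : ∀ xs ys {zs : List (A ⊎ B)} →
                       Interleaving (map inj₁ xs) (map inj₂ ys) zs → lefts zs ≡ xs
  Interleaving⇒lefts []       []       []           = refl
  Interleaving⇒lefts (x ∷ xs) []       (refl ∷ˡ sp) = cong (x ∷_) (Interleaving⇒lefts xs [] sp)
  Interleaving⇒lefts []       (y ∷ ys) (refl ∷ʳ sp) = Interleaving⇒lefts [] ys sp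
  Interleaving⇒lefts (x ∷ xs) (y ∷ ys) (refl ∷ˡ sp) = cong (x ∷_) (Interleaving⇒lefts xs (y ∷ ys) sp)
  Interleaving⇒lefts (x ∷ xs) (y ∷ ys) (refl ∷ʳ sp) = Interleaving⇒lefts (x ∷ xs) ys sp

  Interleaving⇒rights : ∀ xs ys {zs : List (A ⊎ B)} →
                        Interleaving (map inj₁ xs) (map inj₂ ys) zs → rights zs ≡ ys
  Interleaving⇒rights []       []       []           = refl
  Interleaving⇒rights (x ∷ xs) []       (refl ∷ˡ sp) = Interleaving⇒rights xs [] sp
  Interleaving⇒rights []       (y ∷ ys) (refl ∷ʳ sp) = cong (y ∷_) (Interleaving⇒rights [] ys sp)
  Interleaving⇒rights (x ∷ xs) (y ∷ ys) (refl ∷ˡ sp) = Interleaving⇒rights xs (y ∷ ys) sp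
  Interleaving⇒rights (x ∷ xs) (y ∷ ys) (refl ∷ʳ sp) = cong (y ∷_) (Interleaving⇒rights (x ∷ xs) ys sp)

  interleaving : ∀ {xs ys} (zs : List (A ⊎ B)) → lefts zs ≡ xs → rights zs ≡ ys →
                 Interleaving (map inj₁ xs) (map inj₂ ys) zs
  interleaving []            refl refl = []
  interleaving (inj₁ x ∷ zs) refl refl = refl ∷ˡ interleaving zs refl refl
  interleaving (inj₂ y ∷ zs) refl refl = refl ∷ʳ interleaving zs refl refl

module _ {A B C D : Set} (f : A → C) (g : B → D) where

  lefts-map : ∀ zs → lefts (map (Sum.map f g) zs) ≡ map f (lefts zs)
  lefts-map []            = refl
  lefts-map (inj₁ x ∷ zs) = cong (f x ∷_) (lefts-map zs)
  lefts-map (inj₂ y ∷ zs) = lefts-map zs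

  rights-map : ∀ zs → rights (map (Sum.map f g) zs) ≡ map g (rights zs)
  rights-map []            = refl
  rights-map (inj₁ x ∷ zs) = rights-map zs
  rights-map (inj₂ y ∷ zs) = cong (g y ∷_) (rights-map zs)

-- Positions of left entries among the right ones

-- `k` counts the right entries in front of an occurrence of `inj₁ x`. A relation and not a
-- function: `x` may be absent or occur several times, and uniqueness of `k` is a theorem about
-- shuffles.
data Before {A B : Set} (x : A) : ℕ → List (A ⊎ B) → Set where
  here  : ∀ {zs} → Before x zero (inj₁ x ∷ zs)
  left  : ∀ {k y zs} → Before x k zs → Before x k (inj₁ y ∷ zs)
  right : ∀ {k y zs} → Before x k zs → Before x (suc k) (inj₂ y ∷ zs)

module _ {A B : Set} where

  ∈⇒Before : ∀ {x} (zs : List (A ⊎ B)) → x ∈ lefts zs → ∃ λ k → Before x k zs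
  ∈⇒Before (inj₁ _ ∷ zs) (here refl) = zero , here
  ∈⇒Before (inj₁ _ ∷ zs) (there i)   = let k , b = ∈⇒Before zs i in k , left b
  ∈⇒Before (inj₂ _ ∷ zs) i           = let k , b = ∈⇒Before zs i in suc k , right b

  Before⇒∈ : ∀ {x k} {zs : List (A ⊎ B)} → Before x k zs → x ∈ lefts zs
  Before⇒∈ here      = here refl
  Before⇒∈ (left b)  = there (Before⇒∈ b)
  Before⇒∈ (right b) = Before⇒∈ b

  Before⇒≤ : ∀ {x k} {zs : List (A ⊎ B)} → Before x k zs → k ℕ.≤ length (rights zs)
  Before⇒≤ here      = z≤n
  Before⇒≤ (left b)  = Before⇒≤ b
  Before⇒≤ (right b) = s≤s (Before⇒≤ b)

  Before-++⁺ˡ : ∀ {x k} {zs ws : List (A ⊎ B)} → Before x k zs → Before x k (zs ++ ws)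
  Before-++⁺ˡ here      = here
  Before-++⁺ˡ (left b)  = left (Before-++⁺ˡ b)
  Before-++⁺ˡ (right b) = right (Before-++⁺ˡ b)

  Before-++⁺ʳ : ∀ {x k} (zs : List (A ⊎ B)) {ws} → Before x k ws →
                Before x (length (rights zs) + k) (zs ++ ws)
  Before-++⁺ʳ []            b = b
  Before-++⁺ʳ (inj₁ _ ∷ zs) b = left (Before-++⁺ʳ zs b)
  Before-++⁺ʳ (inj₂ _ ∷ zs) b = right (Before-++⁺ʳ zs b)

  Before-map : ∀ {C D : Set} (f : A → C) (g : B → D) {x k} {zs : List (A ⊎ B)} →
               Before x k zs → Before (f x) k (map (Sum.map f g) zs)
  Before-map f g here      = here
  Before-map f g (left b)  = left (Before-map f g b)
  Before-map f g (right b) = right (Before-map f g b)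

  -- Takes a position back from the labels to the chain that carries them: the chain is cut at a
  -- point labelled `x`, and `k` becomes the number of right labels below the cut. This is the form
  -- in which two chains can be glued.
  Before-split : ∀ {C : Set} (label : C → A ⊎ B) {x k} cs → Before x k (map label cs) →
                 ∃₂ λ l a → ∃ λ u → cs ≡ l ++ a ∷ u × label a ≡ inj₁ x ×
                                    length (rights (map label l)) ≡ k
  Before-split label (c ∷ cs) b with label c in eq
  Before-split label (c ∷ cs) here      | inj₁ _ = [] , c , cs , refl , eq , refl
  Before-split label (c ∷ cs) (left b)  | inj₁ _ =
    let l , a , u , cs≡ , lab , len = Before-split label cs b
    in c ∷ l , a , u , cong (c ∷_) cs≡ , lab ,
       trans (cong (length ∘ rights ∘ (_∷ map label l)) eq) len
  Before-split label (c ∷ cs) (right b) | inj₂ _ =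
    let l , a , u , cs≡ , lab , len = Before-split label cs b
    in c ∷ l , a , u , cong (c ∷_) cs≡ , lab ,
       trans (cong (length ∘ rights ∘ (_∷ map label l)) eq) (cong suc len)

  Before-skip : ∀ {x y k} {zs : List (A ⊎ B)} → x ≢ y → Before x k (inj₁ y ∷ zs) → Before x k zs
  Before-skip x≢y here     = contradiction refl x≢y
  Before-skip x≢y (left b) = b

  -- Heads of the same kind agree and are removed together. Heads of different kinds cannot occur: a
  -- left entry heading one list has only position 0 there, the left entries being distinct, whereas
  -- in the other list a right entry precedes it.
  Before-determines : ∀ (zs ws : List (A ⊎ B)) → AllPairs _≢_ (lefts zs) →
                      lefts zs ≡ lefts ws → rights zs ≡ rights ws →
                      (∀ {x} → x ∈ lefts zs → ∃ λ k → Before x k zs × Before x k ws) → zs ≡ ws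
  Before-determines []            []            _        _    _    _ = refl
  Before-determines []            (inj₁ _ ∷ _)  _        ()   _    _
  Before-determines []            (inj₂ _ ∷ _)  _        _    ()   _
  Before-determines (inj₁ _ ∷ _)  []            _        ()   _    _
  Before-determines (inj₂ _ ∷ _)  []            _        _    ()   _
  Before-determines (inj₁ x ∷ zs) (inj₁ y ∷ ws) (x∉ ∷ d) l≡   r≡   agree
    with refl , l≡′ ← ∷-injective l≡ =
    cong (inj₁ x ∷_) (Before-determines zs ws d l≡′ r≡ λ i →
      let k , b , c = agree (there i)
          z≢x = All.lookup x∉ i ∘ sym
      in k , Before-skip z≢x b , Before-skip z≢x c)
  Before-determines (inj₂ x ∷ zs) (inj₂ y ∷ ws) d        l≡   r≡   agree
    with refl , r≡′ ← ∷-injective r≡ =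
    cong (inj₂ x ∷_) (Before-determines zs ws d l≡ r≡′ λ i → tails (agree i))
    where
    tails : ∀ {z} → (∃ λ k → Before z k (inj₂ x ∷ zs) × Before z k (inj₂ x ∷ ws)) →
            ∃ λ k → Before z k zs × Before z k ws
    tails (_ , right b , right c) = _ , b , c
  Before-determines (inj₁ x ∷ zs) (inj₂ y ∷ ws) (x∉ ∷ _) _    _    agree
    with agree (here refl)
  ... | suc k , left b , right c = contradiction refl (All.lookup x∉ (Before⇒∈ b))
  Before-determines (inj₂ x ∷ zs) (inj₁ y ∷ ws) d        l≡   _    agree
    with agree {y} (subst (y ∈_) (sym l≡) (here refl))
  ... | suc k , right b , left c =
    contradiction refl (All.lookup (AllPairs.head (subst (AllPairs _≢_) l≡ d)) (Before⇒∈ c))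

-- From shuffles to order-preserving maps

module Order (P : FinPoset) where
  open FinPoset P public using (_≤_; _<_)
  open IsPartialOrder (FinPoset.isPartialOrder P) public
    using () renaming (refl to ≤-refl; trans to ≤-trans; antisym to ≤-antisym)

  <-trans : ∀ {x y z} → x < y → y < z → x < z
  <-trans = ToStrict.<-trans _≡_ _≤_ (FinPoset.isPartialOrder P)

  ≤⇒≯ : ∀ {x y} → x ≤ y → y < x → {A : Set} → A
  ≤⇒≯ x≤y (y≤x , y≢x) = contradiction (≤-antisym y≤x x≤y) y≢x

-- Exchanging the upper parts of maximal chains

module _ {A : Set} {R : A → A → Set} where

  AllPairs-++⁻ʳ : ∀ xs {ys} → AllPairs R (xs ++ ys) → AllPairs R ys
  AllPairs-++⁻ʳ []       rs       = rs
  AllPairs-++⁻ʳ (_ ∷ xs) (_ ∷ rs) = AllPairs-++⁻ʳ xs rs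

  AllPairs-before : ∀ xs {a ys} → AllPairs R (xs ++ a ∷ ys) → ∀ {x} → x ∈ xs → R x a
  AllPairs-before (_ ∷ xs) (r ∷ _)  (here refl) = All.head (All.++⁻ʳ xs r)
  AllPairs-before (_ ∷ xs) (_ ∷ rs) (there i)   = AllPairs-before xs rs i

  AllPairs-after : ∀ xs {a ys} → AllPairs R (xs ++ a ∷ ys) → ∀ {y} → y ∈ ys → R a y
  AllPairs-after xs rs = All.lookup (AllPairs.head (AllPairs-++⁻ʳ xs rs))

module _ (P : FinPoset) where
  open Order P

  glue-increasing : ∀ l {a u} l′ {u′} → AllPairs _<_ (l ++ a ∷ u) → AllPairs _<_ (l′ ++ a ∷ u′) →
                    AllPairs _<_ (l ++ a ∷ u′)
  glue-increasing []      l′ _        inc′ = AllPairs-++⁻ʳ l′ inc′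
  glue-increasing (x ∷ l) l′ (r ∷ rs) inc′ =
    All.++⁺ (All.++⁻ˡ l r) (x<a ∷ All.map (<-trans x<a) (AllPairs.head (AllPairs-++⁻ʳ l′ inc′)))
    ∷ glue-increasing l l′ rs inc′
    where x<a = All.head (All.++⁻ʳ l r)

  -- A point comparable with the whole new chain is comparable with `a`. If it lies below `a`, it is
  -- comparable with all of `M` by transitivity, so the maximality of `M` puts it into `l` or at
  -- `a`; if it lies above `a`, the same argument works with `M′`.
  glue : ∀ (M M′ : MaximalChain P) {l a u l′ u′} →
         points M ≡ l ++ a ∷ u → points M′ ≡ l′ ++ a ∷ u′ → MaximalChain P
  glue record { points = .(l ++ a ∷ u) ; increasing = inc ; maximal = max }
       record { points = .(l′ ++ a ∷ u′) ; increasing = inc′ ; maximal = max′ }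
       {l} {a} {u} {l′} {u′} refl refl = record
    { points     = l ++ a ∷ u′
    ; increasing = glue-increasing l l′ inc inc′
    ; maximal    = glued
    }
    where
    glued : ∀ x → (∀ {y} → y ∈ l ++ a ∷ u′ → x ≤ y ⊎ y ≤ x) → x ∈ l ++ a ∷ u′
    glued x cmp with cmp (∈-++⁺ʳ l (here refl))
    ... | inj₁ x≤a = keep (∈-++⁻ l (max x λ i → compare (∈-++⁻ l i)))
      where
      compare : ∀ {y} → y ∈ l ⊎ y ∈ a ∷ u → x ≤ y ⊎ y ≤ x
      compare (inj₁ i)           = cmp (∈-++⁺ˡ i)
      compare (inj₂ (here refl)) = inj₁ x≤a
      compare (inj₂ (there i))   = inj₁ (≤-trans x≤a (proj₁ (AllPairs-after l inc i)))
      keep : x ∈ l ⊎ x ∈ a ∷ u → x ∈ l ++ a ∷ u′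
      keep (inj₁ i)           = ∈-++⁺ˡ i
      keep (inj₂ (here refl)) = ∈-++⁺ʳ l (here refl)
      keep (inj₂ (there i))   = ≤⇒≯ x≤a (AllPairs-after l inc i)
    ... | inj₂ a≤x = keep (∈-++⁻ l′ (max′ x λ i → compare (∈-++⁻ l′ i)))
      where
      compare : ∀ {y} → y ∈ l′ ⊎ y ∈ a ∷ u′ → x ≤ y ⊎ y ≤ x
      compare (inj₁ i)           = inj₂ (≤-trans (proj₁ (AllPairs-before l′ inc′ i)) a≤x)
      compare (inj₂ (here refl)) = inj₂ a≤x
      compare (inj₂ (there i))   = cmp (∈-++⁺ʳ l (there i))
      keep : x ∈ l′ ⊎ x ∈ a ∷ u′ → x ∈ l ++ a ∷ u′
      keep (inj₁ i) = ≤⇒≯ a≤x (AllPairs-before l′ inc′ i)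
      keep (inj₂ i) = ∈-++⁺ʳ l i

  glue-points : ∀ (M M′ : MaximalChain P) {l a u l′ u′}
                (e : points M ≡ l ++ a ∷ u) (e′ : points M′ ≡ l′ ++ a ∷ u′) →
                points (glue M M′ e e′) ≡ l ++ a ∷ u′
  glue-points M M′ refl refl = refl

  -- In an increasing list `q` cannot stand in front of `p`, as it would then be strictly smaller;
  -- so every right entry in front of `p` is in front of `q` too.
  Before-mono : ∀ {B : Set} {zs : List (Carrier P ⊎ B)} → AllPairs _<_ (lefts zs) →
                ∀ {p q k l} → p ≤ q → Before p k zs → Before q l zs → k ℕ.≤ l
  Before-mono inc       p≤q here      c         = z≤n
  Before-mono (q< ∷ _)  p≤q (left b)  here      = ≤⇒≯ p≤q (All.lookup q< (Before⇒∈ b))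
  Before-mono (_ ∷ inc) p≤q (left b)  (left c)  = Before-mono inc p≤q b c
  Before-mono inc       p≤q (right b) (right c) = s≤s (Before-mono inc p≤q b c)

-- Independence of positions from the chain

module _ {P : FinPoset} {n : ℕ} (S : Shuffle P n) where
  open Shuffle S

  lefts-labels : ∀ M → lefts (labels M) ≡ points M
  lefts-labels M = Interleaving⇒lefts (points M) (allFin n) (shuffled M)

  rights-labels : ∀ M → rights (labels M) ≡ allFin n
  rights-labels M = Interleaving⇒rights (points M) (allFin n) (shuffled M)

  length-rights-labels : ∀ M → length (rights (labels M)) ≡ n
  length-rights-labels M = trans (cong length (rights-labels M)) (length-tabulate id)

  private
    weight : List (Carrier A) → ℕ
    weight = length ∘ rights ∘ map label

    weight-++ : ∀ l {a p} u → label a ≡ inj₁ p → weight (l ++ a ∷ u) ≡ weight l + weight u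
    weight-++ l {a} {p} u eq = begin
      length (rights (map label (l ++ a ∷ u)))         ≡⟨ cong (length ∘ rights) (map-++ label l (a ∷ u)) ⟩
      length (rights (map label l ++ label a ∷ map label u))
        ≡⟨ cong (λ z → length (rights (map label l ++ z ∷ map label u))) eq ⟩
      length (rights (map label l ++ inj₁ p ∷ map label u))
        ≡⟨ cong length (mapMaybe-++ isInj₂ (map label l) (inj₁ p ∷ map label u)) ⟩
      length (rights (map label l) ++ rights (map label u))
        ≡⟨ length-++ (rights (map label l)) ⟩
      weight l + weight u ∎
      where open ≡-Reasoning

  Before-unique : ∀ {p k k′} M M′ → Before p k (labels M) → Before p k′ (labels M′) → k ≡ k′
  Before-unique {p} M M′ b b′
    with l  , a  , u  , e  , lab  , refl ← Before-split label (points (Inverse.to chains M)) b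
    with l′ , a′ , u′ , e′ , lab′ , refl ← Before-split label (points (Inverse.to chains M′)) b′
    -- Each point of `P` labels a single point of `A`, so both chains pass through the same `a` and
    -- can be exchanged there.
    with refl ← trans (sym (proj₂ (proj₂ (unique p)) lab)) (proj₂ (proj₂ (unique p)) lab′)
    -- `l` and `l′` are completed by the same upper part `u′`, once in the glued chain and once in
    -- the chain of `M′`; both totals are `n`.
    = ℕ.+-cancelʳ-≡ (weight u′) (weight l) (weight l′) (trans lu′≡n (sym l′u′≡n))
    where
    -- The glued chain is a chain of `A` alone. Bijectivity of `chains` makes it the image of a
    -- maximal chain of `P`, which is why it carries exactly `n` labels from `⟨ n ⟩`.
    C = glue A (Inverse.to chains M) (Inverse.to chains M′) e e′
    lu′≡n : weight l + weight u′ ≡ n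
    lu′≡n = begin
      weight l + weight u′                                ≡⟨ weight-++ l u′ lab ⟨
      weight (l ++ a ∷ u′)                                ≡⟨ cong weight (glue-points A _ _ e e′) ⟨
      weight (points C)                                   ≡⟨ cong weight (Inverse.strictlyInverseˡ chains C) ⟨
      weight (points (Inverse.to chains (Inverse.from chains C)))
        ≡⟨ length-rights-labels (Inverse.from chains C) ⟩
      n                                                   ∎
      where open ≡-Reasoning
    l′u′≡n : weight l′ + weight u′ ≡ n
    l′u′≡n = begin
      weight l′ + weight u′                ≡⟨ weight-++ l′ u′ lab ⟨
      weight (l′ ++ a ∷ u′)                ≡⟨ cong weight e′ ⟨
      weight (points (Inverse.to chains M′)) ≡⟨ length-rights-labels M′ ⟩
      n                                    ∎
      where open ≡-Reasoning

-- Order-preserving maps as invariants of shuffles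

-- Values in `ℕ` with a separate bound instead of values in `Fin (suc n)`: raising or lowering the
-- bound then leaves the function alone and changes only a proof.
OrderMap : FinPoset → ℕ → Set
OrderMap P n = Σ (Carrier P → ℕ) λ h →
  (∀ {p q} → FinPoset._≤_ P p q → h p ℕ.≤ h q) × (∀ p → h p ℕ.≤ n)

OrderMaps : FinPoset → ℕ → Setoid _ _
OrderMaps P n = record
  { Carrier       = OrderMap P n
  ; _≈_           = λ g h → ∀ p → proj₁ g p ≡ proj₁ h p
  ; isEquivalence = record
    { refl  = λ _ → refl
    ; sym   = λ e p → sym (e p)
    ; trans = λ e f p → trans (e p) (f p)
    }
  }

Realizes : ∀ {P n} → Shuffle P n → (Carrier P → ℕ) → Set
Realizes {P} S h = ∀ M {p} → p ∈ points M → Before p (h p) (Shuffle.labels S M)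

-- The invariant of the induction over series-parallel posets. Positions of `p` and `q` can be
-- compared only along a common chain, hence `through`. In an empty poset the empty chain is
-- maximal, which would spoil the description of the chains of a disjoint union, hence `inhabitant`.
record Shuffleable (P : FinPoset) : Set₁ where
  field
    inhabitant : Carrier P
    through    : ∀ {p q} → FinPoset._≤_ P p q → ∃ λ M → p ∈ points {P} M × q ∈ points M
    realize    : ∀ {n} (h : OrderMap P n) → Σ (Shuffle P n) λ S → Realizes S (proj₁ h)

module _ {P : FinPoset} {n : ℕ} where
  open Order P

  Realizes-determines : ∀ (S T : Shuffle P n) {h g} → (∀ p → h p ≡ g p) →
                        Realizes S h → Realizes T g → Setoid._≈_ (Shuffles P n) S T
  Realizes-determines S T h≗g Sh Tg M = Before-determines _ _
    (subst (AllPairs _≢_) (sym (lefts-labels S M)) (AllPairs.map proj₂ (increasing M)))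
    (trans (lefts-labels S M) (sym (lefts-labels T M)))
    (trans (rights-labels S M) (sym (rights-labels T M)))
    λ {p} i → let j = subst (p ∈_) (lefts-labels S M) i
              in _ , Sh M j , subst (λ k → Before p k _) (sym (h≗g p)) (Tg M j)

  module _ (shuffleable : Shuffleable P) where
    open Shuffleable shuffleable

    private
      position : ∀ (S : Shuffle P n) M {p} → p ∈ points M → ∃ λ k → Before p k (Shuffle.labels S M)
      position S M {p} i = ∈⇒Before _ (subst (p ∈_) (sym (lefts-labels S M)) i)

      chain : ∀ p → ∃ λ M → p ∈ points {P} M
      chain p = let M , i , _ = through (≤-refl {p}) in M , i

      rank : Shuffle P n → Carrier P → ℕ
      rank S p = proj₁ (position S (proj₁ (chain p)) (proj₂ (chain p)))

      Before-rank : ∀ S p → Before p (rank S p) (Shuffle.labels S (proj₁ (chain p)))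
      Before-rank S p = proj₂ (position S (proj₁ (chain p)) (proj₂ (chain p)))

      Realizes-rank : ∀ S → Realizes S (rank S)
      Realizes-rank S M {p} i with k , b ← position S M i
        rewrite Before-unique S (proj₁ (chain p)) M (Before-rank S p) b = b

      rank-mono : ∀ S {p q} → p ≤ q → rank S p ℕ.≤ rank S q
      rank-mono S p≤q with M , i , j ← through p≤q =
        Before-mono P (subst (AllPairs _<_) (sym (lefts-labels S M)) (increasing M))
          p≤q (Realizes-rank S M i) (Realizes-rank S M j)

      rank-bounded : ∀ S p → rank S p ℕ.≤ n
      rank-bounded S p = subst (rank S p ℕ.≤_) (length-rights-labels S _) (Before⇒≤ (Before-rank S p))

      rankMap : Shuffle P n → OrderMap P n
      rankMap S = rank S , rank-mono S , rank-bounded S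

    -- `realize` merely chooses one shuffle for each map. It is nevertheless a two-sided inverse,
    -- since any two shuffles that realize equal maps have equal label sequences.
    Shuffles↔OrderMaps : Inverse (Shuffles P n) (OrderMaps P n)
    Shuffles↔OrderMaps = mkInverse
      rankMap
      (λ h → proj₁ (realize h))
      (λ {S} {T} S≈T p → Before-unique T (proj₁ (chain p)) (proj₁ (chain p))
        (subst (Before p (rank S p)) (S≈T (proj₁ (chain p))) (Before-rank S p)) (Before-rank T p))
      (λ {g} {h} g≈h → Realizes-determines (proj₁ (realize g)) (proj₁ (realize h)) g≈h
        (proj₂ (realize g)) (proj₂ (realize h)))
      (λ h p → Before-unique (proj₁ (realize h)) (proj₁ (chain p)) (proj₁ (chain p))
        (Before-rank (proj₁ (realize h)) p) (proj₂ (realize h) (proj₁ (chain p)) (proj₂ (chain p))))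
      (λ S → Realizes-determines (proj₁ (realize (rankMap S))) S (λ _ → refl)
        (proj₂ (realize (rankMap S))) (Realizes-rank S))

-- Maximal chains and extremal points of sums

-- Every point is vacuously comparable with the members of the empty list, so in an inhabited poset
-- that list is not maximal.
∃-point : ∀ {P} → Carrier P → (M : MaximalChain P) → ∃ λ p → p ∈ points M
∃-point x record { points = [] ; maximal = max } with () ← max x (λ ())
∃-point x record { points = p ∷ _ }              = p , here refl

module _ (P Q : FinPoset) where
  private
    module P = Order P
    module Q = Order Q
    module ⊕ = Order (P ⊕ Q)

  -- No point of `P` can follow a point of `Q` in an increasing list, so sorting by summand changes
  -- nothing.
  ⊕-decompose : ∀ {zs} → AllPairs ⊕._<_ zs → map inj₁ (lefts zs) ++ map inj₂ (rights zs) ≡ zs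
  ⊕-decompose {[]}          []        = refl
  ⊕-decompose {inj₁ x ∷ zs} (_ ∷ inc) = cong (inj₁ x ∷_) (⊕-decompose inc)
  ⊕-decompose {inj₂ y ∷ zs} (y< ∷ inc) with lefts zs | no-lefts y< | ⊕-decompose inc
    where
    no-lefts : ∀ {ws} → All (inj₂ y ⊕.<_) ws → lefts ws ≡ []
    no-lefts {[]}         []            = refl
    no-lefts {inj₁ _ ∷ _} ((() , _) ∷ _)
    no-lefts {inj₂ _ ∷ _} (_ ∷ y<)      = no-lefts y<
  ... | [] | refl | eq = cong (inj₂ y ∷_) eq

  -- Points of `P` are comparable with all points of `Q`, so comparability with the lower half of a
  -- chain already gives comparability with the whole.
  lower : MaximalChain (P ⊕ Q) → MaximalChain P
  lower M = record
    { points     = lefts (points M)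
    ; increasing = AllPairs-lefts⁺ (λ (le , ne) → drop-inj₁ le , ne ∘ cong inj₁) (increasing M)
    ; maximal    = λ x cmp → ∈-lefts⁺ (maximal M (inj₁ x) λ
        { {inj₁ y} i → Sum.map ₁∼₁ ₁∼₁ (cmp (∈-lefts⁺ i))
        ; {inj₂ y} i → inj₁ ₁∼₂ })
    }

  upper : MaximalChain (P ⊕ Q) → MaximalChain Q
  upper M = record
    { points     = rights (points M)
    ; increasing = AllPairs-rights⁺ (λ (le , ne) → drop-inj₂ le , ne ∘ cong inj₂) (increasing M)
    ; maximal    = λ y cmp → ∈-rights⁺ (maximal M (inj₂ y) λ
        { {inj₁ x} i → inj₂ ₁∼₂
        ; {inj₂ x} i → Sum.map ₂∼₂ ₂∼₂ (cmp (∈-rights⁺ i)) })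
    }

  concatenate : MaximalChain P → MaximalChain Q → MaximalChain (P ⊕ Q)
  concatenate M N = record
    { points     = map inj₁ (points M) ++ map inj₂ (points N)
    ; increasing = AllPairs.++⁺
        (AllPairs.map⁺ (AllPairs.map (λ (le , ne) → ₁∼₁ le , ne ∘ inj₁-injective) (increasing M)))
        (AllPairs.map⁺ (AllPairs.map (λ (le , ne) → ₂∼₂ le , ne ∘ inj₂-injective) (increasing N)))
        (All.map⁺ (All.universal (λ _ → All.map⁺ (All.universal (λ _ → ₁∼₂ , λ ()) _)) _))
    ; maximal    = λ where
        (inj₁ x) cmp → ∈-++⁺ˡ (∈-map⁺ inj₁ (maximal M x λ i →
          Sum.map drop-inj₁ drop-inj₁ (cmp (∈-++⁺ˡ (∈-map⁺ inj₁ i)))))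
        (inj₂ y) cmp → ∈-++⁺ʳ (map inj₁ (points M)) (∈-map⁺ inj₂ (maximal N y λ i →
          Sum.map drop-inj₂ drop-inj₂ (cmp (∈-++⁺ʳ (map inj₁ (points M)) (∈-map⁺ inj₂ i)))))
    }

  ⊕-chains : Inverse (MaximalChains (P ⊕ Q)) (MaximalChains P ×ₛ MaximalChains Q)
  ⊕-chains = mkInverse
    (λ M → lower M , upper M)
    (λ (M , N) → concatenate M N)
    (λ M≈ → cong lefts M≈ , cong rights M≈)
    (λ (M≈ , N≈) → cong₂ (λ xs ys → map inj₁ xs ++ map inj₂ ys) M≈ N≈)
    (λ (M , N) →
      trans (mapMaybe-++ isInj₁ (map inj₁ (points M)) _)
        (trans (cong₂ _++_ (mapMaybeIsInj₁∘mapInj₁ (points M)) (mapMaybeIsInj₁∘mapInj₂ (points N)))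
          (++-identityʳ (points M))) ,
      trans (mapMaybe-++ isInj₂ (map inj₁ (points M)) _)
        (cong₂ _++_ (mapMaybeIsInj₂∘mapInj₁ (points M)) (mapMaybeIsInj₂∘mapInj₂ (points N))))
    (λ M → ⊕-decompose (increasing M))

  -- The point `p` lies below all of `Q`, which keeps points of `Q` from being minimal.
  ⊕-minimal : Carrier P → Inverse (MinimalPoints P) (MinimalPoints (P ⊕ Q))
  ⊕-minimal p = mkInverse
    (λ (x , min) → inj₁ x , λ where (₁∼₁ y≤x) → cong inj₁ (min y≤x))
    (λ where
      (inj₁ x , min) → x , λ y≤x → inj₁-injective (min (₁∼₁ y≤x))
      (inj₂ y , min) → contradiction (min (₁∼₂ {x = p})) λ ())
    (cong inj₁)
    (λ
      { {inj₁ x , _}   {inj₁ y , _}   eq → inj₁-injective eq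
      ; {inj₂ y , min} {_}            eq → contradiction (min (₁∼₂ {x = p})) λ ()
      ; {_}            {inj₂ y , min} eq → contradiction (min (₁∼₂ {x = p})) λ () })
    (λ where
      (inj₁ x , min) → refl
      (inj₂ y , min) → contradiction (min (₁∼₂ {x = p})) λ ())
    (λ _ → refl)

  ⊕-maximal : Carrier Q → Inverse (MaximalPoints Q) (MaximalPoints (P ⊕ Q))
  ⊕-maximal q = mkInverse
    (λ (x , max) → inj₂ x , λ where (₂∼₂ x≤y) → cong inj₂ (max x≤y))
    (λ where
      (inj₂ x , max) → x , λ x≤y → inj₂-injective (max (₂∼₂ x≤y))
      (inj₁ y , max) → contradiction (max (₁∼₂ {y = q})) λ ())
    (cong inj₂)
    (λ
      { {inj₂ x , _}   {inj₂ y , _}   eq → inj₂-injective eq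
      ; {inj₁ y , max} {_}            eq → contradiction (max (₁∼₂ {y = q})) λ ()
      ; {_}            {inj₁ y , max} eq → contradiction (max (₁∼₂ {y = q})) λ () })
    (λ where
      (inj₂ x , max) → refl
      (inj₁ y , max) → contradiction (max (₁∼₂ {y = q})) λ ())
    (λ _ → refl)

  ⊔-minimal : Inverse (MinimalPoints P ⊎ₛ MinimalPoints Q) (MinimalPoints (P ⊔ Q))
  ⊔-minimal = mkInverse
    (λ where
      (inj₁ (x , min)) → inj₁ x , λ where (inj₁ y≤x) → cong inj₁ (min y≤x)
      (inj₂ (x , min)) → inj₂ x , λ where (inj₂ y≤x) → cong inj₂ (min y≤x))
    (λ where
      (inj₁ x , min) → inj₁ (x , λ y≤x → inj₁-injective (min (inj₁ y≤x)))
      (inj₂ x , min) → inj₂ (x , λ y≤x → inj₂-injective (min (inj₂ y≤x))))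
    (λ where
      (inj₁ eq) → cong inj₁ eq
      (inj₂ eq) → cong inj₂ eq)
    (λ
      { {inj₁ x , _} {inj₁ y , _} eq → inj₁ (inj₁-injective eq)
      ; {inj₂ x , _} {inj₂ y , _} eq → inj₂ (inj₂-injective eq) })
    (λ where
      (inj₁ x , _) → refl
      (inj₂ x , _) → refl)
    (λ where
      (inj₁ x) → inj₁ refl
      (inj₂ x) → inj₂ refl)

  ⊔-maximal : Inverse (MaximalPoints P ⊎ₛ MaximalPoints Q) (MaximalPoints (P ⊔ Q))
  ⊔-maximal = mkInverse
    (λ where
      (inj₁ (x , max)) → inj₁ x , λ where (inj₁ x≤y) → cong inj₁ (max x≤y)
      (inj₂ (x , max)) → inj₂ x , λ where (inj₂ x≤y) → cong inj₂ (max x≤y))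
    (λ where
      (inj₁ x , max) → inj₁ (x , λ x≤y → inj₁-injective (max (inj₁ x≤y)))
      (inj₂ x , max) → inj₂ (x , λ x≤y → inj₂-injective (max (inj₂ x≤y))))
    (λ where
      (inj₁ eq) → cong inj₁ eq
      (inj₂ eq) → cong inj₂ eq)
    (λ
      { {inj₁ x , _} {inj₁ y , _} eq → inj₁ (inj₁-injective eq)
      ; {inj₂ x , _} {inj₂ y , _} eq → inj₂ (inj₂-injective eq) })
    (λ where
      (inj₁ x , _) → refl
      (inj₂ x , _) → refl)
    (λ where
      (inj₁ x) → inj₁ refl
      (inj₂ x) → inj₂ refl)

module _ (P Q : FinPoset) (p₀ : Carrier P) (q₀ : Carrier Q) where
  private
    module P = Order P
    module Q = Order Q
    module ⊔ = Order (P ⊔ Q)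

  -- Maximality against points of `Q` holds because the chain has at least one point, and that point
  -- is incomparable with all of `Q`.
  inj₁-chain : MaximalChain P → MaximalChain (P ⊔ Q)
  inj₁-chain M = record
    { points     = map inj₁ (points M)
    ; increasing =
        AllPairs.map⁺ (AllPairs.map (λ (le , ne) → inj₁ le , ne ∘ inj₁-injective) (increasing M))
    ; maximal    = λ where
        (inj₁ x) cmp → ∈-map⁺ inj₁ (maximal M x λ i →
          Sum.map (λ { (inj₁ le) → le }) (λ { (inj₁ le) → le }) (cmp (∈-map⁺ inj₁ i)))
        (inj₂ y) cmp → contradiction (cmp (∈-map⁺ inj₁ (proj₂ (∃-point p₀ M))))
          λ { (inj₁ ()) ; (inj₂ ()) }
    }

  inj₂-chain : MaximalChain Q → MaximalChain (P ⊔ Q)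
  inj₂-chain M = record
    { points     = map inj₂ (points M)
    ; increasing =
        AllPairs.map⁺ (AllPairs.map (λ (le , ne) → inj₂ le , ne ∘ inj₂-injective) (increasing M))
    ; maximal    = λ where
        (inj₂ x) cmp → ∈-map⁺ inj₂ (maximal M x λ i →
          Sum.map (λ { (inj₂ le) → le }) (λ { (inj₂ le) → le }) (cmp (∈-map⁺ inj₂ i)))
        (inj₁ y) cmp → contradiction (cmp (∈-map⁺ inj₂ (proj₂ (∃-point q₀ M))))
          λ { (inj₁ ()) ; (inj₂ ()) }
    }

  -- Carries the equation of points along with the chain, so that the laws of `⊔-chains` are proved
  -- for arbitrary components by matching, without unfolding `component`.
  Component : MaximalChain (P ⊔ Q) → Set
  Component M = (Σ (MaximalChain P) λ M₁ → points M ≡ map inj₁ (points M₁))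
              ⊎ (Σ (MaximalChain Q) λ M₂ → points M ≡ map inj₂ (points M₂))

  -- The first point decides the summand: all later points are comparable with it.
  component : ∀ M → Component M
  component record { points = [] ; maximal = max } with () ← max (inj₁ p₀) (λ ())
  component record { points = inj₁ x ∷ zs ; increasing = x< ∷ inc ; maximal = max } = inj₁
    (record
      { points     = x ∷ lefts zs
      ; increasing = AllPairs-lefts⁺ (λ { (inj₁ le , ne) → le , ne ∘ cong inj₁ }) (x< ∷ inc)
      ; maximal    = λ y cmp → ∈-lefts⁺ (max (inj₁ y) λ
          { {inj₁ z} i         → Sum.map inj₁ inj₁ (cmp (∈-lefts⁺ i))
          ; {inj₂ z} (there i) → contradiction (proj₁ (All.lookup x< i)) λ () })
      } , cong (inj₁ x ∷_) (all-left x<))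
    where
    all-left : ∀ {ws} → All (inj₁ x ⊔.<_) ws → ws ≡ map inj₁ (lefts ws)
    all-left {[]}          []       = refl
    all-left {inj₁ w ∷ ws} (_ ∷ x<) = cong (inj₁ w ∷_) (all-left x<)
    all-left {inj₂ w ∷ ws} ((() , _) ∷ _)
  component record { points = inj₂ x ∷ zs ; increasing = x< ∷ inc ; maximal = max } = inj₂
    (record
      { points     = x ∷ rights zs
      ; increasing = AllPairs-rights⁺ (λ { (inj₂ le , ne) → le , ne ∘ cong inj₂ }) (x< ∷ inc)
      ; maximal    = λ y cmp → ∈-rights⁺ (max (inj₂ y) λ
          { {inj₁ z} (there i) → contradiction (proj₁ (All.lookup x< i)) λ ()
          ; {inj₂ z} i         → Sum.map inj₂ inj₂ (cmp (∈-rights⁺ i)) })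
      } , cong (inj₂ x ∷_) (all-right x<))
    where
    all-right : ∀ {ws} → All (inj₂ x ⊔.<_) ws → ws ≡ map inj₂ (rights ws)
    all-right {[]}          []       = refl
    all-right {inj₁ w ∷ ws} ((() , _) ∷ _)
    all-right {inj₂ w ∷ ws} (_ ∷ x<) = cong (inj₂ w ∷_) (all-right x<)

  private
    disjoint : ∀ (M : MaximalChain P) {ys : List (Carrier Q)} {A : Set} →
               map {B = Carrier (P ⊔ Q)} inj₁ (points M) ≡ map inj₂ ys → A
    disjoint M eq with p , i ← ∃-point p₀ M
      with () ← ∈-map⁻ inj₂ (subst (inj₁ p ∈_) eq (∈-map⁺ inj₁ i))

    map-inj₁-injective : ∀ {xs ys : List (Carrier P)} →
                         map (inj₁ {B = Carrier Q}) xs ≡ map inj₁ ys → xs ≡ ys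
    map-inj₁-injective = map-injective inj₁-injective

    map-inj₂-injective : ∀ {xs ys : List (Carrier Q)} →
                         map (inj₂ {A = Carrier P}) xs ≡ map inj₂ ys → xs ≡ ys
    map-inj₂-injective = map-injective inj₂-injective

    include : MaximalChain P ⊎ MaximalChain Q → MaximalChain (P ⊔ Q)
    include = Sum.[ inj₁-chain , inj₂-chain ]

  ⊔-chains : Inverse (MaximalChains (P ⊔ Q)) (MaximalChains P ⊎ₛ MaximalChains Q)
  ⊔-chains = mkInverse
    (λ M → Sum.map proj₁ proj₁ (component M))
    include
    (λ {M} {N} M≈N → to-cong {M} {N} (component M) (component N) M≈N)
    (λ where
      (inj₁ eq) → cong (map inj₁) eq
      (inj₂ eq) → cong (map inj₂) eq)
    (λ where
      (inj₁ M) → to∘from₁ M (component (inj₁-chain M))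
      (inj₂ N) → to∘from₂ N (component (inj₂-chain N)))
    (λ M → from∘to M (component M))
    where
    to-cong : ∀ {M N} (C : Component M) (D : Component N) → points M ≡ points N →
              Setoid._≈_ (MaximalChains P ⊎ₛ MaximalChains Q) (Sum.map proj₁ proj₁ C) (Sum.map proj₁ proj₁ D)
    to-cong (inj₁ (M , e)) (inj₁ (N , f)) eq = inj₁ (map-inj₁-injective (trans (sym e) (trans eq f)))
    to-cong (inj₂ (M , e)) (inj₂ (N , f)) eq = inj₂ (map-inj₂-injective (trans (sym e) (trans eq f)))
    to-cong (inj₁ (M , e)) (inj₂ (N , f)) eq = disjoint M (trans (sym e) (trans eq f))
    to-cong (inj₂ (M , e)) (inj₁ (N , f)) eq = disjoint N (trans (sym f) (trans (sym eq) e))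

    to∘from₁ : ∀ M (C : Component (inj₁-chain M)) →
               Setoid._≈_ (MaximalChains P ⊎ₛ MaximalChains Q) (Sum.map proj₁ proj₁ C) (inj₁ M)
    to∘from₁ M (inj₁ (_ , e)) = inj₁ (sym (map-inj₁-injective e))
    to∘from₁ M (inj₂ (_ , e)) = disjoint M e

    to∘from₂ : ∀ N (C : Component (inj₂-chain N)) →
               Setoid._≈_ (MaximalChains P ⊎ₛ MaximalChains Q) (Sum.map proj₁ proj₁ C) (inj₂ N)
    to∘from₂ N (inj₁ (M , e)) = disjoint M (sym e)
    to∘from₂ N (inj₂ (_ , e)) = inj₂ (sym (map-inj₂-injective e))

    from∘to : ∀ M (C : Component M) →
              points (include (Sum.map proj₁ proj₁ C)) ≡ points M
    from∘to M (inj₁ (_ , e)) = sym e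
    from∘to M (inj₂ (_ , e)) = sym e

-- Realizing order-preserving maps by shuffles

map-inj₁⁻ : ∀ {A B C D : Set} {f : A → C} {g : B → D} z {y} →
            Sum.map f g z ≡ inj₁ y → ∃ λ x → z ≡ inj₁ x × f x ≡ y
map-inj₁⁻ (inj₁ x) eq = x , refl , inj₁-injective eq

allFin-+ : ∀ k m → map (_↑ˡ m) (allFin k) ++ map (k ↑ʳ_) (allFin m) ≡ allFin (k + m)
allFin-+ zero    m = map-id (allFin m)
allFin-+ (suc k) m = cong (zero ∷_) (begin
  map (_↑ˡ m) (tabulate suc) ++ map (suc k ↑ʳ_) (allFin m)
    ≡⟨ cong₂ _++_ (trans (map-tabulate suc (_↑ˡ m)) (sym (map-tabulate (_↑ˡ m) suc))) (map-∘ (allFin m)) ⟩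
  tail (tabulate (_↑ˡ m)) (map (k ↑ʳ_) (allFin m))
    ≡⟨ cong (λ xs → tail xs (map (k ↑ʳ_) (allFin m))) (map-tabulate id (_↑ˡ m)) ⟨
  tail (map (_↑ˡ m) (allFin k)) (map (k ↑ʳ_) (allFin m))
    ≡⟨ map-++ suc (map (_↑ˡ m) (allFin k)) (map (k ↑ʳ_) (allFin m)) ⟨
  map suc (map (_↑ˡ m) (allFin k) ++ map (k ↑ʳ_) (allFin m))
    ≡⟨ cong (map suc) (allFin-+ k m) ⟩
  map suc (allFin (k + m))
    ≡⟨ map-tabulate id suc ⟩
  tabulate suc ∎)
  where
  open ≡-Reasoning
  tail : List (Fin (k + m)) → List (Fin (k + m)) → List (Fin (suc k + m))
  tail xs ys = map suc xs ++ map suc ys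

module _ {P Q : FinPoset} {k l n : ℕ} (S : Shuffle P k) (T : Shuffle Q l)
         (f : Fin k → Fin n) (g : Fin l → Fin n) where
  private
    module S = Shuffle S
    module T = Shuffle T

  -- `f` and `g` place the two label chains in a common one. For `⊔` both are `id`, as each summand
  -- is shuffled with the whole chain; for `⊕` they are `_↑ˡ l` and `k ↑ʳ_`, as the chain is cut in
  -- two.
  sumLabel : Carrier S.A ⊎ Carrier T.A → (Carrier P ⊎ Carrier Q) ⊎ Fin n
  sumLabel = Sum.[ Sum.map inj₁ f ∘ S.label , Sum.map inj₂ g ∘ T.label ]

  sumLabel-unique : ∀ p → ∃ λ a → sumLabel a ≡ inj₁ p × (∀ {b} → sumLabel b ≡ inj₁ p → a ≡ b)
  sumLabel-unique (inj₁ p) = let a , la , a! = S.unique p in inj₁ a , cong (Sum.map inj₁ f) la , λ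
    { {inj₁ b} eq → let p′ , e , e′ = map-inj₁⁻ (S.label b) eq
                    in cong inj₁ (a! (trans e (cong inj₁ (inj₁-injective e′))))
    ; {inj₂ b} eq → let _ , _ , e = map-inj₁⁻ (T.label b) eq in contradiction e λ () }
  sumLabel-unique (inj₂ q) = let a , la , a! = T.unique q in inj₂ a , cong (Sum.map inj₂ g) la , λ
    { {inj₂ b} eq → let p′ , e , e′ = map-inj₁⁻ (T.label b) eq
                    in cong inj₂ (a! (trans e (cong inj₁ (inj₂-injective e′))))
    ; {inj₁ b} eq → let _ , _ , e = map-inj₁⁻ (S.label b) eq in contradiction e λ () }

  map-sumLabel₁ : ∀ xs → map sumLabel (map inj₁ xs) ≡ map (Sum.map inj₁ f) (map S.label xs)
  map-sumLabel₁ xs = trans (sym (map-∘ xs)) (map-∘ xs)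

  map-sumLabel₂ : ∀ xs → map sumLabel (map inj₂ xs) ≡ map (Sum.map inj₂ g) (map T.label xs)
  map-sumLabel₂ xs = trans (sym (map-∘ xs)) (map-∘ xs)

module _ {P Q : FinPoset} (p₀ : Carrier P) (q₀ : Carrier Q) where

  module _ {n : ℕ} (S : Shuffle P n) (T : Shuffle Q n) where
    private
      module S = Shuffle S
      module T = Shuffle T
      label = sumLabel S T id id
      -- The posets underlying the shuffles are inhabited too: they contain the points labelled `p₀`
      -- and `q₀`.
      a₀ = proj₁ (S.unique p₀)
      b₀ = proj₁ (T.unique q₀)
      chains = Composition.inverse (⊔-chains P Q p₀ q₀)
                 (Composition.inverse (S.chains ⊎-inverse T.chains)
                   (Symmetry.inverse (⊔-chains S.A T.A a₀ b₀)))
      labels : MaximalChain (P ⊔ Q) → List _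
      labels M = map label (points (Inverse.to chains M))

      lefts-rights : ∀ M → lefts (labels M) ≡ points M × rights (labels M) ≡ allFin n
      lefts-rights M with component P Q p₀ q₀ M
      ... | inj₁ (M₁ , e) rewrite map-sumLabel₁ S T id id (points (Inverse.to S.chains M₁)) =
        trans (lefts-map inj₁ id (S.labels M₁)) (trans (cong (map inj₁) (lefts-labels S M₁)) (sym e)) ,
        trans (rights-map inj₁ id (S.labels M₁)) (trans (map-id _) (rights-labels S M₁))
      ... | inj₂ (M₂ , e) rewrite map-sumLabel₂ S T id id (points (Inverse.to T.chains M₂)) =
        trans (lefts-map inj₂ id (T.labels M₂)) (trans (cong (map inj₂) (lefts-labels T M₂)) (sym e)) ,
        trans (rights-map inj₂ id (T.labels M₂)) (trans (map-id _) (rights-labels T M₂))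

    ⊔-shuffle : Shuffle (P ⊔ Q) n
    ⊔-shuffle = record
      { A             = S.A ⊔ T.A
      ; label         = label
      ; minimalPoints = Composition.inverse (Symmetry.inverse (⊔-minimal P Q))
                          (Composition.inverse (S.minimalPoints ⊎-inverse T.minimalPoints)
                            (⊔-minimal S.A T.A))
      ; maximalPoints = Composition.inverse (Symmetry.inverse (⊔-maximal P Q))
                          (Composition.inverse (S.maximalPoints ⊎-inverse T.maximalPoints)
                            (⊔-maximal S.A T.A))
      ; chains        = chains
      ; shuffled      = λ M → interleaving (labels M) (proj₁ (lefts-rights M)) (proj₂ (lefts-rights M))
      ; unique        = sumLabel-unique S T id id
      }

    ⊔-realizes : ∀ {h} → Realizes S (h ∘ inj₁) → Realizes T (h ∘ inj₂) → Realizes ⊔-shuffle h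
    ⊔-realizes Sh Th M i with component P Q p₀ q₀ M
    ... | inj₁ (M₁ , e) rewrite map-sumLabel₁ S T id id (points (Inverse.to S.chains M₁))
      with p , j , refl ← ∈-map⁻ inj₁ (subst (_ ∈_) e i) = Before-map inj₁ id (Sh M₁ j)
    ... | inj₂ (M₂ , e) rewrite map-sumLabel₂ S T id id (points (Inverse.to T.chains M₂))
      with q , j , refl ← ∈-map⁻ inj₂ (subst (_ ∈_) e i) = Before-map inj₂ id (Th M₂ j)

  module _ {k l : ℕ} (S : Shuffle P k) (T : Shuffle Q l) where
    private
      module S = Shuffle S
      module T = Shuffle T
      label = sumLabel S T (_↑ˡ l) (k ↑ʳ_)
      a₀ = proj₁ (S.unique p₀)
      b₀ = proj₁ (T.unique q₀)
      chains = Composition.inverse (⊕-chains P Q)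
                 (Composition.inverse (S.chains ×-inverse T.chains)
                   (Symmetry.inverse (⊕-chains S.A T.A)))

      labels₁ labels₂ labels : MaximalChain (P ⊕ Q) → List ((Carrier P ⊎ Carrier Q) ⊎ Fin (k + l))
      labels₁ M = map (Sum.map inj₁ (_↑ˡ l)) (S.labels (lower P Q M))
      labels₂ M = map (Sum.map inj₂ (k ↑ʳ_)) (T.labels (upper P Q M))
      labels M = map label (points (Inverse.to chains M))

      labels-++ : ∀ M → labels M ≡ labels₁ M ++ labels₂ M
      labels-++ M = trans (map-++ label (map inj₁ xs) (map inj₂ ys))
        (cong₂ _++_ (map-sumLabel₁ S T (_↑ˡ l) (k ↑ʳ_) xs) (map-sumLabel₂ S T (_↑ˡ l) (k ↑ʳ_) ys))
        where
        xs = points (Inverse.to S.chains (lower P Q M))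
        ys = points (Inverse.to T.chains (upper P Q M))

      lefts-⊕ : ∀ M → lefts (labels M) ≡ points M
      lefts-⊕ M = begin
        lefts (labels M)                        ≡⟨ cong lefts (labels-++ M) ⟩
        lefts (labels₁ M ++ labels₂ M)          ≡⟨ mapMaybe-++ isInj₁ (labels₁ M) (labels₂ M) ⟩
        lefts (labels₁ M) ++ lefts (labels₂ M)
          ≡⟨ cong₂ _++_ (lefts-map inj₁ (_↑ˡ l) (S.labels (lower P Q M)))
                        (lefts-map inj₂ (k ↑ʳ_) (T.labels (upper P Q M))) ⟩
        map inj₁ (lefts (S.labels (lower P Q M))) ++ map inj₂ (lefts (T.labels (upper P Q M)))
          ≡⟨ cong₂ (λ xs ys → map inj₁ xs ++ map inj₂ ys)
               (lefts-labels S (lower P Q M)) (lefts-labels T (upper P Q M)) ⟩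
        map inj₁ (lefts (points M)) ++ map inj₂ (rights (points M))
          ≡⟨ ⊕-decompose P Q (increasing M) ⟩
        points M ∎
        where open ≡-Reasoning

      rights₁ : ∀ M → rights (labels₁ M) ≡ map (_↑ˡ l) (allFin k)
      rights₁ M = trans (rights-map inj₁ (_↑ˡ l) (S.labels (lower P Q M)))
                        (cong (map (_↑ˡ l)) (rights-labels S (lower P Q M)))

      rights-⊕ : ∀ M → rights (labels M) ≡ allFin (k + l)
      rights-⊕ M = begin
        rights (labels M)                        ≡⟨ cong rights (labels-++ M) ⟩
        rights (labels₁ M ++ labels₂ M)          ≡⟨ mapMaybe-++ isInj₂ (labels₁ M) (labels₂ M) ⟩
        rights (labels₁ M) ++ rights (labels₂ M)
          ≡⟨ cong₂ _++_ (rights₁ M)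
               (trans (rights-map inj₂ (k ↑ʳ_) (T.labels (upper P Q M)))
                      (cong (map (k ↑ʳ_)) (rights-labels T (upper P Q M)))) ⟩
        map (_↑ˡ l) (allFin k) ++ map (k ↑ʳ_) (allFin l)
          ≡⟨ allFin-+ k l ⟩
        allFin (k + l) ∎
        where open ≡-Reasoning

      length-rights₁ : ∀ M → length (rights (labels₁ M)) ≡ k
      length-rights₁ M = trans (cong length (rights₁ M))
        (trans (length-map (_↑ˡ l) (allFin k)) (length-tabulate id))

    ⊕-shuffle : Shuffle (P ⊕ Q) (k + l)
    ⊕-shuffle = record
      { A             = S.A ⊕ T.A
      ; label         = label
      ; minimalPoints = Composition.inverse (Symmetry.inverse (⊕-minimal P Q p₀))
                          (Composition.inverse S.minimalPoints (⊕-minimal S.A T.A a₀))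
      ; maximalPoints = Composition.inverse (Symmetry.inverse (⊕-maximal P Q q₀))
                          (Composition.inverse T.maximalPoints (⊕-maximal S.A T.A b₀))
      ; chains        = chains
      ; shuffled      = λ M → interleaving (labels M) (lefts-⊕ M) (rights-⊕ M)
      ; unique        = sumLabel-unique S T (_↑ˡ l) (k ↑ʳ_)
      }

    -- Every chain runs through all of `⟨ k ⟩` in its lower part, which shifts the positions in the
    -- upper part by `k`.
    ⊕-realizes : ∀ {g h} → Realizes S g → Realizes T h →
                 Realizes ⊕-shuffle Sum.[ g , (λ q → k + h q) ]
    ⊕-realizes Sg Th M {inj₁ p} i = subst (Before _ _) (sym (labels-++ M))
      (Before-++⁺ˡ (Before-map inj₁ (_↑ˡ l) (Sg (lower P Q M) (∈-lefts⁺ i))))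
    ⊕-realizes {h = h} Sg Th M {inj₂ q} i = subst (Before _ _) (sym (labels-++ M))
      (subst (λ m → Before (inj₂ q) (m + h q) (labels₁ M ++ labels₂ M)) (length-rights₁ M)
        (Before-++⁺ʳ (labels₁ M) (Before-map inj₂ (k ↑ʳ_) (Th (upper P Q M) (∈-rights⁺ i)))))

-- Invariance under isomorphism

infix 4 _≃_

-- `_≅_` provides surjectivity; here the inverse is explicit and monotone, so that symmetry swaps
-- fields and each transport lemma serves both directions.
record _≃_ (P Q : FinPoset) : Set where
  private
    module P = FinPoset P
    module Q = FinPoset Q
  field
    to        : P.Carrier → Q.Carrier
    from      : Q.Carrier → P.Carrier
    to∘from   : ∀ y → to (from y) ≡ y
    from∘to   : ∀ x → from (to x) ≡ x
    to-mono   : ∀ {x y} → x P.≤ y → to x Q.≤ to y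
    from-mono : ∀ {x y} → x Q.≤ y → from x P.≤ from y

  to-injective : ∀ {x y} → to x ≡ to y → x ≡ y
  to-injective {x} {y} eq = trans (sym (from∘to x)) (trans (cong from eq) (from∘to y))

≃-sym : ∀ {P Q} → P ≃ Q → Q ≃ P
≃-sym e = record
  { to        = from
  ; from      = to
  ; to∘from   = from∘to
  ; from∘to   = to∘from
  ; to-mono   = from-mono
  ; from-mono = to-mono
  }
  where open _≃_ e

≅⇒≃ : ∀ {P Q} → P ≅ Q → P ≃ Q
≅⇒≃ {P} {Q} (f , iso) = record
  { to        = f
  ; from      = λ y → proj₁ (surjective y)
  ; to∘from   = f∘from
  ; from∘to   = λ x → injective (f∘from (f x))
  ; to-mono   = mono
  ; from-mono = λ {x} {y} x≤y → cancel (subst₂ (FinPoset._≤_ Q) (sym (f∘from x)) (sym (f∘from y)) x≤y)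
  }
  where
  open IsOrderIsomorphism iso
  f∘from : ∀ y → f (proj₁ (surjective y)) ≡ y
  f∘from y = proj₂ (surjective y) refl

map-∘-id : ∀ {A B : Set} {f : A → B} {g : B → A} → (∀ y → f (g y) ≡ y) → ∀ ys → map f (map g ys) ≡ ys
map-∘-id f∘g ys = trans (sym (map-∘ ys)) (trans (map-cong f∘g ys) (map-id ys))

module _ {P Q : FinPoset} (e : P ≃ Q) where
  open _≃_ e
  private
    module P = FinPoset P
    module Q = FinPoset Q

  map-chain : MaximalChain P → MaximalChain Q
  map-chain M = record
    { points     = map to (points M)
    ; increasing =
        AllPairs.map⁺ (AllPairs.map (λ (le , ne) → to-mono le , ne ∘ to-injective) (increasing M))
    ; maximal    = λ y cmp → subst (_∈ map to (points M)) (to∘from y)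
        (∈-map⁺ to (maximal M (from y) λ {x} i →
        Sum.map (subst (from y P.≤_) (from∘to x) ∘ from-mono) (subst (P._≤ from y) (from∘to x) ∘ from-mono)
          (cmp (∈-map⁺ to i))))
    }

  map-minimal : ∀ {x} → Minimal P x → Minimal Q (to x)
  map-minimal {x} min {y} y≤x =
    trans (sym (to∘from y)) (cong to (min (subst (from y P.≤_) (from∘to x) (from-mono y≤x))))

  map-maximal : ∀ {x} → Maximal P x → Maximal Q (to x)
  map-maximal {x} max {y} x≤y =
    trans (sym (to∘from y)) (cong to (max (subst (P._≤ from y) (from∘to x) (from-mono x≤y))))

module _ {P Q : FinPoset} (e : P ≃ Q) where
  open _≃_ e

  ≃-chains : Inverse (MaximalChains P) (MaximalChains Q)
  ≃-chains = mkInverse (map-chain e) (map-chain (≃-sym e)) (cong (map to)) (cong (map from))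
    (λ N → map-∘-id to∘from (points N)) (λ M → map-∘-id from∘to (points M))

  ≃-minimal : Inverse (MinimalPoints P) (MinimalPoints Q)
  ≃-minimal = mkInverse
    (λ (x , min) → to x , map-minimal e min) (λ (y , min) → from y , map-minimal (≃-sym e) min)
    (cong to) (cong from) (to∘from ∘ proj₁) (from∘to ∘ proj₁)

  ≃-maximal : Inverse (MaximalPoints P) (MaximalPoints Q)
  ≃-maximal = mkInverse
    (λ (x , max) → to x , map-maximal e max) (λ (y , max) → from y , map-maximal (≃-sym e) max)
    (cong to) (cong from) (to∘from ∘ proj₁) (from∘to ∘ proj₁)

  module _ {n : ℕ} (S : Shuffle P n) where
    private
      module S = Shuffle S
      label = Sum.map to id ∘ S.label
      pull = map-chain (≃-sym e)
      labels : MaximalChain Q → List _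
      labels N = map label (points (Inverse.to S.chains (pull N)))

      labels≡ : ∀ N → labels N ≡ map (Sum.map to id) (S.labels (pull N))
      labels≡ N = map-∘ (points (Inverse.to S.chains (pull N)))

    ≃-shuffle : Shuffle Q n
    ≃-shuffle = record
      { A             = S.A
      ; label         = label
      ; minimalPoints = Composition.inverse (Symmetry.inverse ≃-minimal) S.minimalPoints
      ; maximalPoints = Composition.inverse (Symmetry.inverse ≃-maximal) S.maximalPoints
      ; chains        = Composition.inverse (Symmetry.inverse ≃-chains) S.chains
      ; shuffled      = λ N → interleaving (labels N)
          (trans (cong lefts (labels≡ N)) (trans (lefts-map to id (S.labels (pull N)))
            (trans (cong (map to) (lefts-labels S (pull N))) (map-∘-id to∘from (points N)))))
          (trans (cong rights (labels≡ N)) (trans (rights-map to id (S.labels (pull N)))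
            (trans (map-id _) (rights-labels S (pull N)))))
      ; unique        = λ q → let a , la , a! = S.unique (from q) in
          a , trans (cong (Sum.map to id) la) (cong inj₁ (to∘from q)) , λ {b} eq →
            let p , lb , to-p≡q = map-inj₁⁻ (S.label b) eq
            in a! (trans lb (cong inj₁ (trans (sym (from∘to p)) (cong from to-p≡q))))
      }

    ≃-realizes : ∀ {h} → Realizes S (h ∘ to) → Realizes ≃-shuffle h
    ≃-realizes {h} Sh N {q} i = subst₂ (λ r → Before r (h r)) (to∘from q) (sym (labels≡ N))
      (Before-map to id (Sh (pull N) (∈-map⁺ from i)))

≃-shuffleable : ∀ {P Q} → P ≃ Q → Shuffleable P → Shuffleable Q
≃-shuffleable e shuffleable = record
  { inhabitant = to inhabitant
  ; through    = λ {x} {y} x≤y → let M , i , j = through (from-mono x≤y) in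
      map-chain e M , subst (_∈ map to (points M)) (to∘from x) (∈-map⁺ to i)
                    , subst (_∈ map to (points M)) (to∘from y) (∈-map⁺ to j)
  ; realize    = λ (h , mono , h≤n) → let S , Sh = realize (h ∘ to , mono ∘ to-mono , h≤n ∘ to) in
      ≃-shuffle e S , ≃-realizes e S {h} Sh
  }
  where
  open _≃_ e
  open Shuffleable shuffleable

OrderMaps-≃ : ∀ {P Q} → P ≃ Q → ∀ n → Inverse (OrderMaps P n) (OrderMaps Q n)
OrderMaps-≃ e n = mkInverse
  (λ (h , mono , h≤n) → h ∘ from , mono ∘ from-mono , h≤n ∘ from)
  (λ (h , mono , h≤n) → h ∘ to , mono ∘ to-mono , h≤n ∘ to)
  (λ g≈h → g≈h ∘ from) (λ g≈h → g≈h ∘ to)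
  (λ (h , _) y → cong h (to∘from y)) (λ (h , _) x → cong h (from∘to x))
  where open _≃_ e

-- The poset ⟨ 1 ⟩

module _ (P : FinPoset) where
  open Order P

  private
    head≤ : ∀ {x z xs} → All (x <_) xs → z ∈ x ∷ xs → x ≤ z
    head≤ x< (here refl) = ≤-refl
    head≤ x< (there i)   = proj₁ (All.lookup x< i)

    tail∈ : ∀ {x z xs} → x < z → z ∈ x ∷ xs → z ∈ xs
    tail∈ x<z (here refl) = contradiction refl (proj₂ x<z)
    tail∈ x<z (there i)   = i

  -- Both heads are least among the common members, so antisymmetry identifies them; strictness
  -- keeps this head out of the tails.
  increasing-≡ : ∀ {xs ys} → AllPairs _<_ xs → AllPairs _<_ ys →
                 (∀ {z} → z ∈ xs → z ∈ ys) → (∀ {z} → z ∈ ys → z ∈ xs) → xs ≡ ys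
  increasing-≡ {[]}     {[]}     _ _ _ _ = refl
  increasing-≡ {[]}     {y ∷ ys} _ _ _ ⊇ with () ← ⊇ (here refl)
  increasing-≡ {x ∷ xs} {[]}     _ _ ⊆ _ with () ← ⊆ (here refl)
  increasing-≡ {x ∷ xs} {y ∷ ys} (x< ∷ inc) (y< ∷ inc′) ⊆ ⊇
    with refl ← ≤-antisym (head≤ x< (⊇ (here refl))) (head≤ y< (⊆ (here refl)))
    = cong (x ∷_) (increasing-≡ inc inc′
        (λ i → tail∈ (All.lookup x< i) (⊆ (there i))) (λ i → tail∈ (All.lookup y< i) (⊇ (there i))))

allFin-chain : ∀ n → MaximalChain ⟨ n ⟩
allFin-chain n = record
  { points     = allFin n
  ; increasing = AllPairs.tabulate⁺-< λ i<j → ℕ.<⇒≤ i<j , Fin.<⇒≢ i<j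
  ; maximal    = λ i _ → ∈-allFin i
  }

-- In a total order every point is comparable with every chain, so a maximal chain contains all
-- points.
allFin-chain-unique : ∀ {n} (M : MaximalChain ⟨ n ⟩) → allFin n ≡ points M
allFin-chain-unique {n} M = increasing-≡ ⟨ n ⟩ (increasing (allFin-chain n)) (increasing M)
  (λ {i} _ → maximal M i λ {j} _ → Fin.≤-total i j) (λ {i} _ → ∈-allFin i)

zero-minimal : ∀ n → Minimal ⟨ suc n ⟩ zero
zero-minimal n {zero} _ = refl

fromℕ-maximal : ∀ n → Maximal ⟨ suc n ⟩ (fromℕ n)
fromℕ-maximal n {i} n≤i = Fin.≤-antisym (Fin.≤fromℕ i) n≤i

-- Away from `i = k` this is `punchOut`: the point of `⟨ 1 ⟩` sits at index `k` of `⟨ suc n ⟩`, and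
-- the remaining indices carry `⟨ n ⟩` in order.
insertLabel : ∀ {n} → Fin (suc n) → Fin (suc n) → Fin 1 ⊎ Fin n
insertLabel         zero    zero    = inj₁ zero
insertLabel         zero    (suc i) = inj₂ i
insertLabel {suc n} (suc k) zero    = inj₂ zero
insertLabel {suc n} (suc k) (suc i) = Sum.map id suc (insertLabel k i)

insertLabel-self : ∀ {n} (k : Fin (suc n)) → insertLabel k k ≡ inj₁ zero
insertLabel-self         zero    = refl
insertLabel-self {suc n} (suc k) = cong (Sum.map id suc) (insertLabel-self k)

insertLabel-unique : ∀ {n} (k i : Fin (suc n)) {p} → insertLabel k i ≡ inj₁ p → k ≡ i
insertLabel-unique         zero    zero    eq = refl
insertLabel-unique {suc n} (suc k) (suc i) eq =
  let _ , eq′ , _ = map-inj₁⁻ (insertLabel k i) eq in cong suc (insertLabel-unique k i eq′)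

insertLabels : ∀ {n} → Fin (suc n) → List (Fin 1 ⊎ Fin n)
insertLabels {n} k = map (insertLabel k) (allFin (suc n))

insertLabels-zero : ∀ n → insertLabels {n} zero ≡ inj₁ zero ∷ map inj₂ (allFin n)
insertLabels-zero n = cong (inj₁ zero ∷_)
  (trans (map-tabulate suc (insertLabel zero)) (sym (map-tabulate id inj₂)))

insertLabels-suc : ∀ {n} (k : Fin (suc n)) →
                   insertLabels (suc k) ≡ inj₂ zero ∷ map (Sum.map id suc) (insertLabels k)
insertLabels-suc {n} k = cong (inj₂ zero ∷_) (begin
  map (insertLabel (suc k)) (tabulate suc)                  ≡⟨ map-tabulate suc (insertLabel (suc k)) ⟩
  tabulate (Sum.map id suc ∘ insertLabel k)                 ≡⟨ map-tabulate id (Sum.map id suc ∘ insertLabel k) ⟨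
  map (Sum.map id suc ∘ insertLabel k) (allFin (suc n))     ≡⟨ map-∘ (allFin (suc n)) ⟩
  map (Sum.map id suc) (insertLabels k)                     ∎)
  where open ≡-Reasoning

lefts-insertLabels : ∀ {n} (k : Fin (suc n)) → lefts (insertLabels k) ≡ zero ∷ []
lefts-insertLabels {n} zero = trans (cong lefts (insertLabels-zero n))
  (cong (zero ∷_) (mapMaybeIsInj₁∘mapInj₂ (allFin n)))
lefts-insertLabels {suc n} (suc k) = trans (cong lefts (insertLabels-suc k))
  (trans (lefts-map id suc (insertLabels k)) (trans (map-id _) (lefts-insertLabels k)))

rights-insertLabels : ∀ {n} (k : Fin (suc n)) → rights (insertLabels k) ≡ allFin n
rights-insertLabels {n} zero = trans (cong rights (insertLabels-zero n)) (mapMaybeIsInj₂∘mapInj₂ (allFin n))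
rights-insertLabels {suc n} (suc k) = trans (cong rights (insertLabels-suc k))
  (cong (zero ∷_) (trans (rights-map id suc (insertLabels k))
    (trans (cong (map suc) (rights-insertLabels k)) (map-tabulate id suc))))

Before-insertLabels : ∀ {n} (k : Fin (suc n)) → Before zero (toℕ k) (insertLabels k)
Before-insertLabels zero = here
Before-insertLabels {suc n} (suc k) = subst (Before zero (suc (toℕ k))) (sym (insertLabels-suc k))
  (right (Before-map id suc (Before-insertLabels k)))

-- A point shuffled with a chain is again a chain, so all three bijections are between one-element
-- setoids.
point-shuffle : ∀ {n} → Fin (suc n) → Shuffle ⟨ 1 ⟩ n
point-shuffle {n} k = record
  { A             = ⟨ suc n ⟩
  ; label         = insertLabel k
  ; minimalPoints = singletons (zero , zero-minimal 0) (zero , zero-minimal n)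
                      (λ { (zero , _) → refl }) (λ { (_ , min) → min z≤n })
  ; maximalPoints = singletons (zero , fromℕ-maximal 0) (fromℕ n , fromℕ-maximal n)
                      (λ { (zero , _) → refl }) (λ { (i , max) → max (Fin.≤fromℕ i) })
  ; chains        = singletons (allFin-chain 1) (allFin-chain (suc n))
                      allFin-chain-unique allFin-chain-unique
  ; shuffled      = λ M → interleaving (insertLabels k)
                      (trans (lefts-insertLabels k) (allFin-chain-unique M)) (rights-insertLabels k)
  ; unique        = λ { zero → k , insertLabel-self k , λ {i} → insertLabel-unique k i }
  }

point-shuffleable : Shuffleable ⟨ 1 ⟩
point-shuffleable = record
  { inhabitant = zero
  ; through    = λ {i} {j} _ → allFin-chain 1 , ∈-allFin i , ∈-allFin j
  ; realize    = λ (h , _ , h≤n) → point-shuffle (fromℕ< (s≤s (h≤n zero))) , λ where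
      M {zero} _ → subst (λ k → Before zero k (insertLabels (fromℕ< (s≤s (h≤n zero)))))
                     (Fin.toℕ-fromℕ< (s≤s (h≤n zero))) (Before-insertLabels (fromℕ< (s≤s (h≤n zero))))
  }

-- Shuffleability of disjoint unions and ordinal sums

⊔-shuffleable : ∀ {P Q} → Shuffleable P → Shuffleable Q → Shuffleable (P ⊔ Q)
⊔-shuffleable {P} {Q} sP sQ = record
  { inhabitant = inj₁ p₀
  ; through    = λ where
      (inj₁ x≤y) → let M , i , j = Shuffleable.through sP x≤y
                   in inj₁-chain P Q p₀ q₀ M , ∈-map⁺ inj₁ i , ∈-map⁺ inj₁ j
      (inj₂ x≤y) → let M , i , j = Shuffleable.through sQ x≤y
                   in inj₂-chain P Q p₀ q₀ M , ∈-map⁺ inj₂ i , ∈-map⁺ inj₂ j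
  ; realize    = λ (h , mono , h≤n) →
      let S , Sh = Shuffleable.realize sP (h ∘ inj₁ , mono ∘ inj₁ , h≤n ∘ inj₁)
          T , Th = Shuffleable.realize sQ (h ∘ inj₂ , mono ∘ inj₂ , h≤n ∘ inj₂)
      in ⊔-shuffle p₀ q₀ S T , ⊔-realizes p₀ q₀ S T {h} Sh Th
  }
  where
  p₀ = Shuffleable.inhabitant sP
  q₀ = Shuffleable.inhabitant sQ

argmax : ∀ {n} → Fin n → (f : Fin n → ℕ) → ∃ λ i → ∀ j → f j ℕ.≤ f i
argmax {suc zero}    _ f = zero , λ { zero → ℕ.≤-refl }
argmax {suc (suc n)} _ f with i , max ← argmax zero (f ∘ suc) with ℕ.≤-total (f zero) (f (suc i))
... | inj₁ f0≤ = suc i , λ { zero → f0≤ ; (suc j) → max j }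
... | inj₂ ≤f0 = zero , λ { zero → ℕ.≤-refl ; (suc j) → ℕ.≤-trans (max j) ≤f0 }

module Maximum (P : FinPoset) (x₀ : Carrier P) where
  private
    module E = Inverse (FinPoset.enumeration P)
    top : (h : Carrier P → ℕ) → ∃ λ i → ∀ j → h (E.from j) ℕ.≤ h (E.from i)
    top h = argmax (E.to x₀) (h ∘ E.from)

  -- Taken as the value of `h` at a point where it is largest, so that any bound of `h` immediately
  -- bounds it.
  maximum : (Carrier P → ℕ) → ℕ
  maximum h = h (E.from (proj₁ (top h)))

  ≤maximum : ∀ h p → h p ℕ.≤ maximum h
  ≤maximum h p = subst (λ q → h q ℕ.≤ maximum h) (E.strictlyInverseʳ p) (proj₂ (top h) (E.to p))

  maximum-least : ∀ {h n} → (∀ p → h p ℕ.≤ n) → maximum h ℕ.≤ n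
  maximum-least h≤n = h≤n _

  maximum-cong : ∀ {g h} → (∀ p → g p ≡ h p) → maximum g ≡ maximum h
  maximum-cong {g} {h} g≗h = ℕ.≤-antisym
    (maximum-least λ p → ℕ.≤-trans (ℕ.≤-reflexive (g≗h p)) (≤maximum h p))
    (maximum-least λ p → ℕ.≤-trans (ℕ.≤-reflexive (sym (g≗h p))) (≤maximum g p))

⊕-shuffleable : ∀ {P Q} → Shuffleable P → Shuffleable Q → Shuffleable (P ⊕ Q)
⊕-shuffleable {P} {Q} sP sQ = record
  { inhabitant = inj₁ p₀
  ; through    = λ where
      (₁∼₁ x≤y) → let M , i , j = Shuffleable.through sP x≤y
                      N , _     = Shuffleable.through sQ (Order.≤-refl Q {q₀})
                  in concatenate P Q M N , ∈-++⁺ˡ (∈-map⁺ inj₁ i) , ∈-++⁺ˡ (∈-map⁺ inj₁ j)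
      (₂∼₂ x≤y) → let M , _     = Shuffleable.through sP (Order.≤-refl P {p₀})
                      N , i , j = Shuffleable.through sQ x≤y
                  in concatenate P Q M N , ∈-++⁺ʳ _ (∈-map⁺ inj₂ i) , ∈-++⁺ʳ _ (∈-map⁺ inj₂ j)
      (₁∼₂ {x} {y}) → let M , i , _ = Shuffleable.through sP (Order.≤-refl P {x})
                          N , j , _ = Shuffleable.through sQ (Order.≤-refl Q {y})
                      in concatenate P Q M N , ∈-++⁺ˡ (∈-map⁺ inj₁ i) , ∈-++⁺ʳ _ (∈-map⁺ inj₂ j)
  ; realize    = realize
  }
  where
  p₀ = Shuffleable.inhabitant sP
  q₀ = Shuffleable.inhabitant sQ
  open Maximum P p₀

  realize : ∀ {n} (h : OrderMap (P ⊕ Q) n) → Σ (Shuffle (P ⊕ Q) n) λ S → Realizes S (proj₁ h)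
  realize (h , mono , h≤n)
    -- The cut of `⟨ n ⟩` comes right after the maximum `k` on `P`. Values on `P` then fit below
    -- `k`, and values on `Q` are at least `k` by monotonicity across the sum, so subtracting `k`
    -- from them loses nothing.
    with m , refl ← ℕ.m≤n⇒∃[o]m+o≡n (maximum-least {h ∘ inj₁} (h≤n ∘ inj₁)) =
    ⊕-shuffle p₀ q₀ S T , realizes
    where
    k = maximum (h ∘ inj₁)
    lowerMap : OrderMap P k
    lowerMap = h ∘ inj₁ , mono ∘ ₁∼₁ , ≤maximum (h ∘ inj₁)
    upperMap : OrderMap Q m
    upperMap = (λ q → h (inj₂ q) ∸ k) , (λ x≤y → ℕ.∸-monoˡ-≤ k (mono (₂∼₂ x≤y))) ,
               λ q → ℕ.≤-trans (ℕ.∸-monoˡ-≤ k (h≤n (inj₂ q))) (ℕ.≤-reflexive (ℕ.m+n∸m≡n k m))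
    S = proj₁ (Shuffleable.realize sP lowerMap)
    T = proj₁ (Shuffleable.realize sQ upperMap)
    k≤h : ∀ q → k ℕ.≤ h (inj₂ q)
    k≤h q = maximum-least {h ∘ inj₁} λ p → mono ₁∼₂
    split : ∀ x → Sum.[ h ∘ inj₁ , (λ q → k + (h (inj₂ q) ∸ k)) ] x ≡ h x
    split (inj₁ p) = refl
    split (inj₂ q) = ℕ.m+[n∸m]≡n (k≤h q)
    realizes : Realizes (⊕-shuffle p₀ q₀ S T) h
    realizes M {x} i = subst (λ j → Before x j (Shuffle.labels (⊕-shuffle p₀ q₀ S T) M)) (split x)
      (⊕-realizes p₀ q₀ S T
        (proj₂ (Shuffleable.realize sP lowerMap)) (proj₂ (Shuffleable.realize sQ upperMap)) M i)

-- Counting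

ℤ-sum : ∀ {n} → (Fin n → ℤ) → ℤ
ℤ-sum = RawMonoid.sum ℤ.+-0-rawMonoid

∑ : ∀ {n} → (Fin n → ℕ) → ℕ
∑ = RawMonoid.sum ℕ.+-0-rawMonoid

Count : ∀ {a ℓ} → Setoid a ℓ → ℕ → Set _
Count S k = Inverse S (setoid (Fin k))

Count-transfer : ∀ {a b ℓ₁ ℓ₂} {S : Setoid a ℓ₁} {T : Setoid b ℓ₂} {k} →
                 Inverse S T → Count T k → Count S k
Count-transfer = Composition.inverse

Count-unique : ∀ {a ℓ} {S : Setoid a ℓ} {k l} → Count S k → Count S l → k ≡ l
Count-unique c d = ↔⇒≡ (Composition.inverse (Symmetry.inverse c) d)

Count-⊎ : ∀ {a b ℓ₁ ℓ₂} {S : Setoid a ℓ₁} {T : Setoid b ℓ₂} {k l} →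
          Count S k → Count T l → Count (S ⊎ₛ T) (k + l)
Count-⊎ c d = Composition.inverse (c ⊎-inverse d)
  (Composition.inverse (⊎.Pointwise-≡↔≡ _ _) (Symmetry.inverse Fin.+↔⊎))

Count-× : ∀ {a b ℓ₁ ℓ₂} {S : Setoid a ℓ₁} {T : Setoid b ℓ₂} {k l} →
          Count S k → Count T l → Count (S ×ₛ T) (k ℕ.* l)
Count-× c d = Composition.inverse (c ×-inverse d)
  (Composition.inverse ×.Pointwise-≡↔≡ (Symmetry.inverse Fin.*↔×))

-- Equality forgets the proof of `D`, so a subset is counted by its elements alone.
Sub : ∀ {a ℓ d} (S : Setoid a ℓ) → (Setoid.Carrier S → Set d) → Setoid _ _
Sub S D = On.setoid S (proj₁ {B = D})

module _ {a ℓ d} (S : Setoid a ℓ) {D : Setoid.Carrier S → Set d} where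
  open Setoid S using () renaming (_≈_ to _≈ₛ_)

  module _ (D? : ∀ x → Dec (D x)) (D-resp : ∀ {x y} → x ≈ₛ y → D x → D y) where

    Sub-split : Inverse S (Sub S D ⊎ₛ Sub S (¬_ ∘ D))
    Sub-split = mkInverse
      (λ x → classify (D? x))
      Sum.[ proj₁ , proj₁ ]
      (λ {x} {y} x≈y → classify-cong x≈y (D? x) (D? y))
      (λ { (inj₁ e) → e ; (inj₂ e) → e })
      (λ { (inj₁ (x , d)) → classify-yes d (D? x) ; (inj₂ (x , ¬d)) → classify-no ¬d (D? x) })
      (λ x → from-classify (D? x))
      where
      classify : ∀ {x} → Dec (D x) → Σ _ D ⊎ Σ _ (¬_ ∘ D)
      classify (yes d) = inj₁ (_ , d)
      classify (no ¬d) = inj₂ (_ , ¬d)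
      classify-cong : ∀ {x y} → x ≈ₛ y → (c : Dec (D x)) (d : Dec (D y)) →
                      Setoid._≈_ (Sub S D ⊎ₛ Sub S (¬_ ∘ D)) (classify c) (classify d)
      classify-cong x≈y (yes _) (yes _) = inj₁ x≈y
      classify-cong x≈y (no _)  (no _)  = inj₂ x≈y
      classify-cong x≈y (yes d) (no ¬d) = contradiction (D-resp x≈y d) ¬d
      classify-cong x≈y (no ¬d) (yes d) = contradiction (D-resp (Setoid.sym S x≈y) d) ¬d
      classify-yes : ∀ {x} (d : D x) c →
                     Setoid._≈_ (Sub S D ⊎ₛ Sub S (¬_ ∘ D)) (classify {x} c) (inj₁ (x , d))
      classify-yes d (yes _) = inj₁ (Setoid.refl S)
      classify-yes d (no ¬d) = contradiction d ¬d
      classify-no : ∀ {x} (¬d : ¬ D x) c →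
                     Setoid._≈_ (Sub S D ⊎ₛ Sub S (¬_ ∘ D)) (classify {x} c) (inj₂ (x , ¬d))
      classify-no ¬d (yes d) = contradiction d ¬d
      classify-no ¬d (no _)  = inj₂ (Setoid.refl S)
      from-classify : ∀ {x} (c : Dec (D x)) → Sum.[ proj₁ , proj₁ ] (classify c) ≈ₛ x
      from-classify (yes _) = Setoid.refl S
      from-classify (no _)  = Setoid.refl S

    Count-split : ∀ {k l} → Count (Sub S D) k → Count (Sub S (¬_ ∘ D)) l → Count S (k + l)
    Count-split c d = Count-transfer Sub-split (Count-⊎ c d)

Sub-≃ : ∀ {a b ℓ₁ ℓ₂ d} {S : Setoid a ℓ₁} {T : Setoid b ℓ₂} {D : Setoid.Carrier S → Set d} →
        (∀ {x y} → Setoid._≈_ S x y → D x → D y) → (i : Inverse S T) →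
        Inverse (Sub S D) (Sub T (D ∘ Inverse.from i))
Sub-≃ {S = S} D-resp i = mkInverse
  (λ (x , d) → I.to x , D-resp (Setoid.sym S (I.strictlyInverseʳ x)) d)
  (λ (y , d) → I.from y , d)
  I.to-cong I.from-cong (λ (y , _) → I.strictlyInverseˡ y) (λ (x , _) → I.strictlyInverseʳ x)
  where module I = Inverse i

Count-Sub-Fin : ∀ {d} k {D : Fin k → Set d} → (∀ i → Dec (D i)) → ∃ λ c → Count (Sub (setoid (Fin k)) D) c
Count-Sub-Fin zero    D? = 0 , mkInverse proj₁ (λ ()) id (λ { {()} }) (λ ()) (λ { (() , _) })
Count-Sub-Fin (suc k) {D} D? with c , tailCount ← Count-Sub-Fin k (D? ∘ suc) | D? zero
... | yes d0 = suc c , mkInverse to from to-cong from-cong to∘from from∘to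
  where
  module T = Inverse tailCount
  to : Σ (Fin (suc k)) D → Fin (suc c)
  to (zero , _)  = zero
  to (suc i , d) = suc (T.to (i , d))
  from : Fin (suc c) → Σ (Fin (suc k)) D
  from zero    = zero , d0
  from (suc j) = suc (proj₁ (T.from j)) , proj₂ (T.from j)
  to-cong : ∀ {x y} → proj₁ x ≡ proj₁ y → to x ≡ to y
  to-cong {zero , _}  {zero , _}  _  = refl
  to-cong {suc _ , _} {suc _ , _} eq = cong suc (T.to-cong (Fin.suc-injective eq))
  from-cong : ∀ {i j} → i ≡ j → proj₁ (from i) ≡ proj₁ (from j)
  from-cong refl = refl
  to∘from : ∀ j → to (from j) ≡ j
  to∘from zero    = refl
  to∘from (suc j) = cong suc (T.strictlyInverseˡ j)
  from∘to : ∀ x → proj₁ (from (to x)) ≡ proj₁ x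
  from∘to (zero , _)  = refl
  from∘to (suc i , d) = cong suc (T.strictlyInverseʳ (i , d))
... | no ¬d0 = c , Count-transfer
  (mkInverse to from (λ {x} {y} → to-cong {x} {y}) (cong suc) (λ _ → refl) from∘to) tailCount
  where
  to : Σ (Fin (suc k)) D → Σ (Fin k) (D ∘ suc)
  to (zero , d)  = contradiction d ¬d0
  to (suc i , d) = i , d
  from : Σ (Fin k) (D ∘ suc) → Σ (Fin (suc k)) D
  from (i , d) = suc i , d
  to-cong : ∀ {x y} → proj₁ x ≡ proj₁ y → proj₁ (to x) ≡ proj₁ (to y)
  to-cong {zero , d}  {_}         _  = contradiction d ¬d0
  to-cong {suc _ , _} {suc _ , _} eq = Fin.suc-injective eq
  from∘to : ∀ x → proj₁ (from (to x)) ≡ proj₁ x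
  from∘to (zero , d)  = contradiction d ¬d0
  from∘to (suc i , d) = refl

-- Asserts only that some count exists. For maps with a prescribed maximum its value is found
-- afterwards, by counting a larger setoid in two ways.
Count-Sub : ∀ {a ℓ d} {S : Setoid a ℓ} {k} {D : Setoid.Carrier S → Set d} → Count S k →
            (∀ x → Dec (D x)) → (∀ {x y} → Setoid._≈_ S x y → D x → D y) → ∃ λ c → Count (Sub S D) c
Count-Sub {S = S} {k} count D? D-resp =
  let c , count′ = Count-Sub-Fin k (D? ∘ Inverse.from count)
  in c , Count-transfer (Sub-≃ {S = S} D-resp count) count′

-- By induction on `m`: the fibre over 0 is split off, and on the rest `κ` is positive, so its
-- predecessor has the same fibres with indices lowered by one.
Count-fibres : ∀ {a ℓ} m (S : Setoid a ℓ) (κ : Setoid.Carrier S → ℕ) →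
               (∀ {x y} → Setoid._≈_ S x y → κ x ≡ κ y) → (∀ x → κ x ℕ.< m) → (c : Fin m → ℕ) →
               (∀ i → Count (Sub S (λ x → κ x ≡ toℕ i)) (c i)) → Count S (∑ c)
Count-fibres zero    S κ κ-cong κ< c counts =
  mkInverse (λ x → contradiction (κ< x) λ ()) (λ ()) (λ {x} _ → contradiction (κ< x) λ ()) (λ { {()} })
    (λ ()) (λ x → contradiction (κ< x) λ ())
Count-fibres (suc m) S κ κ-cong κ< c counts =
  Count-split S {D = λ x → κ x ≡ 0} (λ x → κ x ℕ.≟ 0) (λ x≈y κx≡0 → trans (sym (κ-cong x≈y)) κx≡0)
    (counts zero)
    (Count-fibres m (Sub S (λ x → κ x ≢ 0)) (λ x → ℕ.pred (κ (proj₁ x))) (λ x≈y → cong ℕ.pred (κ-cong x≈y))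
      pred< (c ∘ suc) λ i → Count-transfer (fibre i) (counts (suc i)))
  where
  pred< : ∀ (x : Σ (Setoid.Carrier S) λ s → κ s ≢ 0) → ℕ.pred (κ (proj₁ x)) ℕ.< m
  pred< (x , κx≢0) with κ x | κx≢0 | κ< x
  ... | zero  | 0≢0 | _       = contradiction refl 0≢0
  ... | suc _ | _   | s≤s κ≤m = κ≤m
  fibre : ∀ i → Inverse (Sub (Sub S (λ x → κ x ≢ 0)) (λ x → ℕ.pred (κ (proj₁ x)) ≡ toℕ i))
                        (Sub S (λ x → κ x ≡ suc (toℕ i)))
  fibre i = mkInverse
    (λ ((x , κx≢0) , e) → x , trans (sym (ℕ.suc-pred (κ x) {{ℕ.≢-nonZero κx≢0}})) (cong suc e))
    (λ (x , e) → (x , λ κx≡0 → contradiction (trans (sym κx≡0) e) λ ()) , cong ℕ.pred e)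
    id id (λ _ → Setoid.refl S) (λ _ → Setoid.refl S)

-- Order-preserving maps on sums

OrderMaps-⊔ : ∀ {P Q} n → Inverse (OrderMaps (P ⊔ Q) n) (OrderMaps P n ×ₛ OrderMaps Q n)
OrderMaps-⊔ n = mkInverse
  (λ (h , mono , h≤n) → (h ∘ inj₁ , mono ∘ inj₁ , h≤n ∘ inj₁) , (h ∘ inj₂ , mono ∘ inj₂ , h≤n ∘ inj₂))
  (λ ((g , g-mono , g≤n) , (h , h-mono , h≤n)) →
    Sum.[ g , h ] , (λ { (inj₁ x≤y) → g-mono x≤y ; (inj₂ x≤y) → h-mono x≤y }) , Sum.[ g≤n , h≤n ])
  (λ e → e ∘ inj₁ , e ∘ inj₂)
  (λ (e , f) → Sum.[ e , f ])
  (λ _ → (λ _ → refl) , (λ _ → refl))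
  (λ _ → Sum.[ (λ _ → refl) , (λ _ → refl) ])

module _ (P : FinPoset) (p₀ : Carrier P) where
  open Maximum P p₀

  ExactMaps : ℕ → Setoid _ _
  ExactMaps n = Sub (OrderMaps P n) (λ h → maximum (proj₁ h) ≡ n)

  -- A bound that is not attained can be lowered by one. Hence the maps bounded by n + 1 outnumber
  -- those bounded by n by exactly the maps with maximum n + 1, which is what multiplication by 1 -
  -- x expresses.
  InexactMaps-suc : ∀ n → Inverse (Sub (OrderMaps P (suc n)) (λ h → maximum (proj₁ h) ≢ suc n))
                                  (OrderMaps P n)
  InexactMaps-suc n = mkInverse
    (λ ((h , mono , h≤) , ≢n) → h , mono ,
      λ p → ℕ.≤-trans (≤maximum h p) (ℕ.s≤s⁻¹ (ℕ.≤∧≢⇒< (maximum-least {h} h≤) ≢n)))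
    (λ (h , mono , h≤) → (h , mono , ℕ.m≤n⇒m≤1+n ∘ h≤) , ℕ.<⇒≢ (s≤s (maximum-least {h} h≤)))
    id id (λ _ _ → refl) (λ _ _ → refl)

  ExactMaps-zero : Inverse (ExactMaps 0) (OrderMaps P 0)
  ExactMaps-zero = mkInverse proj₁ (λ h → h , ℕ.n≤0⇒n≡0 (maximum-least {proj₁ h} (proj₂ (proj₂ h))))
    id id (λ _ _ → refl) (λ _ _ → refl)

  Count-ExactMaps : ∀ {n k} → Count (OrderMaps P n) k → ∃ λ e → Count (ExactMaps n) e
  Count-ExactMaps {n} count = Count-Sub count (λ h → maximum (proj₁ h) ℕ.≟ n)
    λ g≈h eq → trans (sym (maximum-cong g≈h)) eq

  Count-OrderMaps-suc : ∀ {n e k} → Count (ExactMaps (suc n)) e → Count (OrderMaps P n) k →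
                        Count (OrderMaps P (suc n)) (e + k)
  Count-OrderMaps-suc {n} c d = Count-split (OrderMaps P (suc n))
    (λ h → maximum (proj₁ h) ℕ.≟ suc n) (λ g≈h eq → trans (sym (maximum-cong g≈h)) eq)
    c (Count-transfer (InexactMaps-suc n) d)

  OrderMaps-⊕ : ∀ Q {n} (i : Fin (suc n)) →
                Inverse (Sub (OrderMaps (P ⊕ Q) n) (λ h → maximum (proj₁ h ∘ inj₁) ≡ toℕ i))
                        (ExactMaps (toℕ i) ×ₛ OrderMaps Q (n ∸ toℕ i))
  OrderMaps-⊕ Q {n} i = mkInverse
    (λ ((h , mono , h≤n) , max≡k) →
      ((h ∘ inj₁ , mono ∘ ₁∼₁ , λ p → subst (h (inj₁ p) ℕ.≤_) max≡k (≤maximum (h ∘ inj₁) p)) , max≡k) ,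
      (λ q → h (inj₂ q) ∸ k) , (λ x≤y → ℕ.∸-monoˡ-≤ k (mono (₂∼₂ x≤y))) ,
      λ q → ℕ.∸-monoˡ-≤ k (h≤n (inj₂ q)))
    (λ (((g , g-mono , g≤k) , max≡k) , (h , h-mono , h≤n-k)) →
      (Sum.[ g , (λ q → k + h q) ] ,
       (λ where
         (₁∼₁ x≤y)     → g-mono x≤y
         (₂∼₂ x≤y)     → ℕ.+-monoʳ-≤ k (h-mono x≤y)
         (₁∼₂ {x} {y}) → ℕ.≤-trans (g≤k x) (ℕ.m≤m+n k (h y))) ,
       λ where
         (inj₁ p) → ℕ.≤-trans (g≤k p) k≤n
         (inj₂ q) → ℕ.≤-trans (ℕ.+-monoʳ-≤ k (h≤n-k q)) (ℕ.≤-reflexive (ℕ.m+[n∸m]≡n k≤n))) ,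
      max≡k)
    (λ e → e ∘ inj₁ , λ q → cong (_∸ k) (e (inj₂ q)))
    (λ (e , f) → Sum.[ e , (λ q → cong (k ℕ.+_) (f q)) ])
    (λ (_ , (h , _)) → (λ _ → refl) , λ q → ℕ.m+n∸m≡n k (h q))
    (λ ((h , mono , _) , max≡k) → Sum.[ (λ _ → refl) ,
      -- Truncated subtraction is undone only for values at least `k`. Each value on `P` is at most
      -- `h (inj₂ q)` by monotonicity, hence so is their maximum `k`.
      (λ q → ℕ.m+[n∸m]≡n (subst (ℕ._≤ h (inj₂ q)) max≡k (maximum-least {h ∘ inj₁} λ p → mono ₁∼₂))) ])
    where
    k = toℕ i
    k≤n = ℕ.s≤s⁻¹ (Fin.toℕ<n i)

-- Series

-- Counterpart of `_IsShuffleSeriesOf_` that counts maps instead of shuffles. The numbers are kept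
-- in `ℕ`, because the products of counts over fibres are cardinalities while the series have
-- integer coefficients.
record _Counts_ (f : PowerSeries) (P : FinPoset) : Set where
  field
    number      : ℕ → ℕ
    counted     : ∀ n → Count (OrderMaps P n) (number n)
    coefficient : ∀ n → f n ≡ + number n

open _Counts_

point-counts : 1/[1-x]² Counts ⟨ 1 ⟩
point-counts .number        = suc
point-counts .counted n     = mkInverse
  (λ (h , _ , h≤n) → fromℕ< (s≤s (h≤n zero)))
  (λ i → (λ _ → toℕ i) , (λ _ → ℕ.≤-refl) , λ _ → ℕ.s≤s⁻¹ (Fin.toℕ<n i))
  (λ g≈h → Fin.fromℕ<-cong _ _ (g≈h zero) _ _)
  (λ { refl _ → refl })
  (λ i → Fin.fromℕ<-toℕ i _)
  (λ { (h , _ , h≤n) zero → Fin.toℕ-fromℕ< (s≤s (h≤n zero)) })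
point-counts .coefficient _ = refl

≃-counts : ∀ {f P Q} → P ≃ Q → f Counts P → f Counts Q
≃-counts e fP .number        = number fP
≃-counts e fP .counted n     = Count-transfer (OrderMaps-≃ (≃-sym e) n) (counted fP n)
≃-counts e fP .coefficient n = coefficient fP n

≈-counts : ∀ {f g P} → f ≈ g → f Counts P → g Counts P
≈-counts f≈g fP .number        = number fP
≈-counts f≈g fP .counted       = counted fP
≈-counts f≈g fP .coefficient n = trans (sym (f≈g n)) (coefficient fP n)

⊔-counts : ∀ {f g P Q} → f Counts P → g Counts Q → γ⊔ f g Counts (P ⊔ Q)
⊔-counts fP gQ .number n      = number fP n ℕ.* number gQ n
⊔-counts {P = P} {Q} fP gQ .counted n =
  Count-transfer (OrderMaps-⊔ {P} {Q} n) (Count-× (counted fP n) (counted gQ n))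
⊔-counts fP gQ .coefficient n =
  trans (cong₂ ℤ._*_ (coefficient fP n) (coefficient gQ n)) (sym (ℤ.pos-* (number fP n) (number gQ n)))

ℤ-sum-pos : ∀ {n} (v : Fin n → ℤ) (c : Fin n → ℕ) → (∀ i → v i ≡ + c i) → ℤ-sum v ≡ + ∑ c
ℤ-sum-pos {zero}  v c v≡c = refl
ℤ-sum-pos {suc n} v c v≡c = cong₂ ℤ._+_ (v≡c zero) (ℤ-sum-pos (v ∘ suc) (c ∘ suc) (v≡c ∘ suc))

·[1-x]-zero : ∀ f → (f · [1-x]) 0 ≡ f 0
·[1-x]-zero f = trans (ℤ.+-identityʳ _) (ℤ.*-identityʳ (f 0))

-- The two nonzero terms stand at the end of the convolution. The first summand vanishes while the
-- index is at least 2, and dropping it shifts `f`.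
·[1-x]-suc : ∀ f n → (f · [1-x]) (suc n) ≡ f (suc n) ℤ.- f n
·[1-x]-suc f zero    = begin
  f 0 ℤ.* -1ℤ ℤ.+ (f 1 ℤ.* 1ℤ ℤ.+ 0ℤ)
    ≡⟨ cong₂ ℤ._+_ (trans (ℤ.*-comm (f 0) -1ℤ) (ℤ.-1*i≡-i (f 0)))
                   (trans (ℤ.+-identityʳ _) (ℤ.*-identityʳ (f 1))) ⟩
  ℤ.- f 0 ℤ.+ f 1
    ≡⟨ ℤ.+-comm (ℤ.- f 0) (f 1) ⟩
  f 1 ℤ.- f 0 ∎
  where open ≡-Reasoning
·[1-x]-suc f (suc n) = trans (cong (ℤ._+ ((f ∘ suc) · [1-x]) (suc n)) (ℤ.*-zeroʳ (f 0)))
  (trans (ℤ.+-identityˡ _) (·[1-x]-suc (f ∘ suc) n))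

module _ {f g : PowerSeries} {P Q : FinPoset} (p₀ : Carrier P) (fP : f Counts P) (gQ : g Counts Q) where
  private
    exact : ∀ n → ∃ λ e → Count (ExactMaps P p₀ n) e
    exact n = Count-ExactMaps P p₀ (counted fP n)

    number-exact : ℕ → ℕ
    number-exact n = proj₁ (exact n)

    number-fibre : ∀ n → Fin (suc n) → ℕ
    number-fibre n i = number-exact (toℕ i) ℕ.* number gQ (n ∸ toℕ i)

    -- A difference of consecutive coefficients is a cardinality here: the maps bounded by n + 1 are
    -- counted once directly and once according to whether the bound is attained.
    coefficient-exact : ∀ n → (f · [1-x]) n ≡ + number-exact n
    coefficient-exact zero    = begin
      (f · [1-x]) 0      ≡⟨ ·[1-x]-zero f ⟩
      f 0                ≡⟨ coefficient fP 0 ⟩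
      + number fP 0      ≡⟨ cong +_ (Count-unique
                              (Count-transfer (ExactMaps-zero P p₀) (counted fP 0)) (proj₂ (exact 0))) ⟩
      + number-exact 0   ∎
      where open ≡-Reasoning
    coefficient-exact (suc n) = begin
      (f · [1-x]) (suc n)       ≡⟨ ·[1-x]-suc f n ⟩
      f (suc n) ℤ.- f n         ≡⟨ cong₂ ℤ._-_ (coefficient fP (suc n)) (coefficient fP n) ⟩
      + number fP (suc n) ℤ.- + k
        ≡⟨ cong (λ l → + l ℤ.- + k) (Count-unique (counted fP (suc n))
             (Count-OrderMaps-suc P p₀ (proj₂ (exact (suc n))) (counted fP n))) ⟩
      (+ e ℤ.+ + k) ℤ.- + k     ≡⟨ ℤ.+-assoc (+ e) (+ k) (ℤ.- + k) ⟩
      + e ℤ.+ (+ k ℤ.- + k)     ≡⟨ cong (λ i → + e ℤ.+ i) (ℤ.+-inverseʳ (+ k)) ⟩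
      + e ℤ.+ 0ℤ                ≡⟨ ℤ.+-identityʳ (+ e) ⟩
      + e                       ∎
      where
      open ≡-Reasoning
      e = number-exact (suc n)
      k = number fP n

  ⊕-counts : γ⊕ f g Counts (P ⊕ Q)
  ⊕-counts .number n      = ∑ (number-fibre n)
  ⊕-counts .counted n     = Count-fibres (suc n) (OrderMaps (P ⊕ Q) n)
    (λ h → maximum (proj₁ h ∘ inj₁))
    (λ g≈h → maximum-cong (g≈h ∘ inj₁))
    (λ (h , _ , h≤n) → s≤s (maximum-least {h ∘ inj₁} (h≤n ∘ inj₁)))
    (number-fibre n)
    (λ i → Count-transfer (OrderMaps-⊕ P p₀ Q i)
             (Count-× (proj₂ (exact (toℕ i))) (counted gQ (n ∸ toℕ i))))
    where open Maximum P p₀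
  -- As `_·_` associates to the left, the i-th summand is `(f · [1-x]) i` times a coefficient of
  -- `g`, which matches the fibre of maps with maximum `i` on `P`.
  ⊕-counts .coefficient n = ℤ-sum-pos _ (number-fibre n) λ i →
    trans (cong₂ ℤ._*_ (coefficient-exact (toℕ i)) (coefficient gQ (n ∸ toℕ i)))
          (sym (ℤ.pos-* (number-exact (toℕ i)) (number gQ (n ∸ toℕ i))))

-- Shuffle series of series-parallel posets and of factorizations

counts⇒shuffleSeries : ∀ {f P} → Shuffleable P → f Counts P → f IsShuffleSeriesOf P
counts⇒shuffleSeries shuffleable fP n =
  number fP n , Count-transfer (Shuffles↔OrderMaps shuffleable) (counted fP n) , coefficient fP n

-- A finite setoid has only one count. With closure of `Generated` under `_≈_`, this makes any given
-- shuffle series generated and not just the one built along the poset.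
shuffleSeries-unique : ∀ {f g P} → f IsShuffleSeriesOf P → g IsShuffleSeriesOf P → f ≈ g
shuffleSeries-unique fP gP n =
  let k , c , fn≡k = fP n
      l , d , gn≡l = gP n
  in trans fn≡k (trans (cong +_ (Count-unique c d)) (sym gn≡l))

tree-seriesParallel : ∀ {n} (t : Tree n) → SeriesParallel (evalPoset t)
tree-seriesParallel leaf                = point
tree-seriesParallel (node ⊔-vertex s t) = disjoint-union (tree-seriesParallel s) (tree-seriesParallel t)
tree-seriesParallel (node ⊕-vertex s t) = ordinal-sum (tree-seriesParallel s) (tree-seriesParallel t)

seriesParallel⇒shuffleable : ∀ {P} → SeriesParallel P → Shuffleable P
seriesParallel⇒shuffleable point                = point-shuffleable
seriesParallel⇒shuffleable (disjoint-union p q) =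
  ⊔-shuffleable (seriesParallel⇒shuffleable p) (seriesParallel⇒shuffleable q)
seriesParallel⇒shuffleable (ordinal-sum p q)    =
  ⊕-shuffleable (seriesParallel⇒shuffleable p) (seriesParallel⇒shuffleable q)
seriesParallel⇒shuffleable (isomorphic e p)     = ≃-shuffleable (≅⇒≃ e) (seriesParallel⇒shuffleable p)

inhabitant : ∀ {P} → SeriesParallel P → Carrier P
inhabitant = Shuffleable.inhabitant ∘ seriesParallel⇒shuffleable

tree-counts : ∀ {n} (t : Tree n) → evalSeries t Counts evalPoset t
tree-counts leaf                = point-counts
tree-counts (node ⊔-vertex s t) = ⊔-counts (tree-counts s) (tree-counts t)
tree-counts (node ⊕-vertex s t) =
  ⊕-counts (inhabitant (tree-seriesParallel s)) (tree-counts s) (tree-counts t)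

-- Follows the derivation of `P` and not a tree, since `isomorphic` may intervene at any stage;
-- there the series stays the same.
seriesParallel⇒counts : ∀ {P} → SeriesParallel P → ∃ λ f → Generated 1/[1-x]² f × f Counts P
seriesParallel⇒counts point                = _ , generator , point-counts
seriesParallel⇒counts (disjoint-union p q) =
  let f , gf , fP = seriesParallel⇒counts p
      g , gg , gQ = seriesParallel⇒counts q
  in _ , γ⊔-closed gf gg , ⊔-counts fP gQ
seriesParallel⇒counts (ordinal-sum p q)    =
  let f , gf , fP = seriesParallel⇒counts p
      g , gg , gQ = seriesParallel⇒counts q
  in _ , γ⊕-closed gf gg , ⊕-counts (inhabitant p) fP gQ
seriesParallel⇒counts (isomorphic e p)     =
  let f , gf , fP = seriesParallel⇒counts p in f , gf , ≃-counts (≅⇒≃ e) fP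

generated⇒counts : ∀ {f} → Generated 1/[1-x]² f → ∃ λ P → SeriesParallel P × f Counts P
generated⇒counts generator         = _ , point , point-counts
generated⇒counts (γ⊔-closed gf gg) =
  let P , p , fP = generated⇒counts gf
      Q , q , gQ = generated⇒counts gg
  in _ , disjoint-union p q , ⊔-counts fP gQ
generated⇒counts (γ⊕-closed gf gg) =
  let P , p , fP = generated⇒counts gf
      Q , q , gQ = generated⇒counts gg
  in _ , ordinal-sum p q , ⊕-counts (inhabitant p) fP gQ
generated⇒counts (respects f≈h gf) =
  let P , p , fP = generated⇒counts gf
  in P , p , ≈-counts f≈h fP

theorem2p23 : (1/[1-x]² IsShuffleSeriesOf ⟨ 1 ⟩)
    × (∀ f → Generated 1/[1-x]² f ⇔ (∃ λ P → SeriesParallel P × f IsShuffleSeriesOf P))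
    × (∀ P → SeriesParallel P → (F : Factorization P) →
    evalSeries (Factorization.tree F) IsShuffleSeriesOf P)
theorem2p23 =
  counts⇒shuffleSeries point-shuffleable point-counts ,
  (λ f → mk⇔
    (λ gf → let P , p , fP = generated⇒counts gf
            in P , p , counts⇒shuffleSeries (seriesParallel⇒shuffleable p) fP)
    (λ (P , p , fP) →
      let g , gg , gP = seriesParallel⇒counts p
      in respects (shuffleSeries-unique (counts⇒shuffleSeries (seriesParallel⇒shuffleable p) gP) fP) gg)) ,
  -- The tree evaluates to `P` only up to isomorphism, so the count is transported; realizability
  -- comes from the derivation `p` of `P` itself.
  λ P p F → counts⇒shuffleSeries (seriesParallel⇒shuffleable p)
    (≃-counts (≅⇒≃ (Factorization.evaluation F)) (tree-counts (Factorization.tree F)))
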